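{- For a hereditary class $\mathcal C$ of graphs, the following are equivalent: (1) $\mathcal C$ has almost bounded merge-width; (2) $\mathcal C$ has almost bounded transient merge-width; (3) $\mathcal C$ has almost bounded partition merge-width; (4) $\mathcal C$ has almost bounded definable merge-width.
   Context: All graphs are finite, simple and undirected; a class is hereditary if closed under induced subgraphs. For a partition $\mathcal P$ of $V(G)$ and $X\subseteq V(G)$, $X/\mathcal P$ denotes the set of parts of $\mathcal P$ intersecting $X$. For $R\subseteq\binom{V(G)}2$, $\mathrm{Ball}^r_R(v)$ is the radius-$r$ ball around $v$ in $(V(G),R)$; similarly for a graph $H$. $\mathcal P$ is homogeneous modulo $R$ if for all parts $X,Y$ (possibly equal), the pairs $\{x,y\}$, $x\in X,y\in Y,x\neq y$, not in $R$, are all edges of $G$ or all non-edges. A merge sequence for $G$ is $(\mathcal P_1,R_1),\dots,(\mathcal P_m,R_m)$ with $\mathcal P_1\preceq\dots\preceq\mathcal P_m$ partitions of $V(G)$, $\mathcal P_1$ into singletons, $\mathcal P_m=\{V(G)\}$, $R_1\subseteq\dots\subseteq R_m$, $\mathcal P_t$ homogeneous modulo $R_t$; radius-$r$ width $\max_{t<m}\max_v|\mathrm{Ball}^r_{R_{t+1}}(v)/\mathcal P_t|$; $\mathrm{mw}_r(G)$ the minimum. A $\mathcal P$-flip of $G$ complements the adjacency between all pairs of distinct vertices in $X\times Y$ for some chosen pairs of parts $(X,Y)$ (possibly $X=Y$). $\mathrm{dist}_{\mathcal P}(x,y)$ is the maximum of $\mathrm{dist}_{G'}(x,y)$ over $\mathcal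 P$-flips $G'$; $\mathrm{Ball}^r_{\mathcal P}$ accordingly. $\mathcal N_S$: elements of $S$ singletons, $u,v\notin S$ together iff $N(u)\cap S=N(v)\cap S$. $\mathrm{tmw}_r(G)$: least $k$ with a sequence $(\mathcal P_1,G_1),\dots,(\mathcal P_m,G_m)$, $\mathcal P_1\preceq\dots\preceq\mathcal P_m$ from singletons to $\{V(G)\}$, $G_i$ a $\mathcal P_i$-flip of $G$, $|\mathrm{Ball}^r_{G_{i+1}}(v)/\mathcal P_i|\le k$ for all $i<m$, $v$. $\mathrm{pmw}_r(G)$: minimum over such chains of $\max_{i<m}\max_v|\mathrm{Ball}^r_{\mathcal P_{i+1}}(v)/\mathcal P_i|$. $\mathrm{dmw}_r(G)$: minimum over orders $v_1<\dots<v_n$ of $\max_{i\le n}\max_v|\mathrm{Ball}^r_{\mathcal P_i}(v)/\mathcal P_i|$ with $\mathcal P_i=\mathcal N_{\{v_1,\dots,v_{n-i}\}}$. A class $\mathcal C$ has almost bounded merge-width if for every $r\in\mathbb N$ and $\varepsilon>0$ there is $n_0$ such that $\mathrm{mw}_r(G)\le n^\varepsilon$ for every $G\in\mathcal C$ with $n\ge n_0$ vertices; almost bounded transient, partition and definable merge-width are defined the same way with $\mathrm{tmw}_r$, $\mathrm{pmw}_r$, $\mathrm{dmw}_r$. -}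

module Defs where

open import Level using (0ℓ; Lift) renaming (suc to lsuc)
open import Data.Nat using (ℕ; zero; suc; _≤_; _<_; _^_; _∸_)
open import Data.Fin using (Fin; toℕ)
open import Data.Bool using (Bool; true; false; _xor_)
open import Data.List using (List; length)
open import Data.List.Relation.Unary.Any using (Any)
open import Data.Product using (Σ; _×_; ∃)
open import Data.Sum using (_⊎_)
open import Relation.Nullary using (¬_)
open import Relation.Binary.PropositionalEquality using (_≡_)
open import Relation.Binary.Core using (Rel)
open import Relation.Binary.Structures using (IsEquivalence)
open import Function.Definitions using (Injective)
open import Function.Bundles using (_⇔_)

record Graph (n : ℕ) : Set where
  field
    adj    : Fin n → Fin n → Bool
    sym    : ∀ x y → adj x y ≡ adj y x
    irrefl : ∀ x → adj x x ≡ false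
open Graph public

induce : ∀ {m n} → Graph n → (Fin m → Fin n) → Graph m
induce G f = record
  { adj = λ x y → adj G (f x) (f y)
  ; sym = λ x y → sym G (f x) (f y)
  ; irrefl = λ x → irrefl G (f x) }

-- a class of graphs and heredity (closure under induced subgraphs,
-- which here includes closure under relabelling)
GraphClass : Set₁
GraphClass = (n : ℕ) → Graph n → Set

Hereditary : GraphClass → Set
Hereditary C = ∀ {m n} (G : Graph n) (f : Fin m → Fin n) →
  Injective _≡_ _≡_ f → C n G → C m (induce G f)

data Reach {n : ℕ} (E : Rel (Fin n) 0ℓ) : ℕ → Fin n → Fin n → Set where
  here : ∀ {r v} → Reach E r v v
  step : ∀ {r v w u} → E v w → Reach E r w u → Reach E (suc r) v u

GEdge : ∀ {n} → Graph n → Rel (Fin n) 0ℓ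
GEdge G x y = adj G x y ≡ true

BEdge : ∀ {n} → (Fin n → Fin n → Bool) → Rel (Fin n) 0ℓ
BEdge R x y = R x y ≡ true

-- Partitions are represented by equivalence relations on Fin n.
-- |X / P| ≤ k : the set X meets at most k parts of P, i.e. X is covered
-- by the parts of at most k vertices.

PartsLE : ∀ {n} → Rel (Fin n) 0ℓ → (Fin n → Set) → ℕ → Set
PartsLE {n} P X k = Σ (List (Fin n)) λ L →
  length L ≤ k × (∀ x → X x → Any (λ y → P x y) L)

IsFlip : ∀ {n} → Rel (Fin n) 0ℓ → Graph n → Graph n → Set
IsFlip {n} P G G' = Σ (Fin n → Fin n → Bool) λ F →
  (∀ x y → F x y ≡ F y x) ×
  (∀ x x' y y' → P x x' → P y y' → F x y ≡ F x' y') ×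
  (∀ x y → ¬ (x ≡ y) → adj G' x y ≡ (adj G x y xor F x y))

FlipBall : ∀ {n} → Rel (Fin n) 0ℓ → Graph n → ℕ → Fin n → Fin n → Set
FlipBall P G r v u = ∀ (G' : Graph _) → IsFlip P G G' → Reach (GEdge G') r v u

-- Chains of partitions P 0 ⪯ P 1 ⪯ … ⪯ P m  (paper's P_1 … P_{m+1})

record Chain (n : ℕ) : Set₁ where
  field
    m      : ℕ
    P      : ℕ → Rel (Fin n) 0ℓ
    equiv  : ∀ t → t ≤ m → IsEquivalence (P t)
    single : ∀ x y → P 0 x y → x ≡ y
    whole  : ∀ x y → P m x y
    coarse : ∀ t → t < m → ∀ x y → P t x y → P (suc t) x y
open Chain public

Homogeneous : ∀ {n} → Graph n → Rel (Fin n) 0ℓ → (Fin n → Fin n → Bool) → Set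
Homogeneous G P R = ∀ x y x' y' → P x x' → P y y' →
  ¬ (x ≡ y) → ¬ (x' ≡ y') → R x y ≡ false → R x' y' ≡ false →
  adj G x y ≡ adj G x' y'

record MergeSeq {n : ℕ} (G : Graph n) : Set₁ where
  field
    chain : Chain n
    R     : ℕ → Fin n → Fin n → Bool
    Rsym  : ∀ t → t ≤ m chain → ∀ x y → R t x y ≡ R t y x
    Rmono : ∀ t → t < m chain → ∀ x y → R t x y ≡ true → R (suc t) x y ≡ true
    homog : ∀ t → t ≤ m chain → Homogeneous G (P chain t) (R t)
open MergeSeq public

mwLE : ℕ → ℕ → ∀ {n} → Graph n → Set₁
mwLE r k G = Σ (MergeSeq G) λ S → ∀ t → t < m (chain S) → ∀ v →
  PartsLE (P (chain S) t) (Reach (BEdge (R S (suc t))) r v) k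

tmwLE : ℕ → ℕ → ∀ {n} → Graph n → Set₁
tmwLE r k {n} G = Σ (Chain n) λ c → Σ (ℕ → Graph n) λ Gs →
  (∀ t → t ≤ m c → IsFlip (P c t) G (Gs t)) ×
  (∀ t → t < m c → ∀ v → PartsLE (P c t) (Reach (GEdge (Gs (suc t))) r v) k)

pmwLE : ℕ → ℕ → ∀ {n} → Graph n → Set₁
pmwLE r k {n} G = Σ (Chain n) λ c →
  ∀ t → t < m c → ∀ v → PartsLE (P c t) (FlipBall (P c (suc t)) G r v) k

NS : ∀ {n} → Graph n → (Fin n → Set) → Rel (Fin n) 0ℓ
NS G S u v = u ≡ v ⊎ (¬ S u × ¬ S v × (∀ w → S w → adj G u w ≡ adj G v w))

-- the order v_1 < … < v_n is given by an injective position map pos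
-- (v_j is the vertex at position j-1); S_i = {v_1, …, v_{n-i}}
dmwLE : ℕ → ℕ → ∀ {n} → Graph n → Set₁
dmwLE r k {n} G = Lift (lsuc 0ℓ) (Σ (Fin n → Fin n) λ pos → Injective _≡_ _≡_ pos ×
  (∀ i → 1 ≤ i → i ≤ n → ∀ v →
     PartsLE (NS G (S pos i)) (FlipBall (NS G (S pos i)) G r v) k))
  where
  S : (Fin n → Fin n) → ℕ → Fin n → Set
  S pos i w = toℕ (pos w) < n ∸ i

-- almost bounded: for every r and ε = 1/(q+1), for large n, width ≤ n^ε,
-- i.e. some k with k^(q+1) ≤ n and width_r(G) ≤ k.

WidthLE : Set₂
WidthLE = ℕ → ℕ → ∀ {n} → Graph n → Set₁

AlmostBounded : WidthLE → GraphClass → Set₁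
AlmostBounded W C = ∀ (r q : ℕ) → ∃ λ n₀ → ∀ n → n₀ ≤ n → ∀ (G : Graph n) →
  C n G → Σ ℕ λ k → k ^ suc q ≤ n × W r k G

{-# OPTIONS --safe #-}
module Submission where

-- A sequence for mw or tmw yields one for pmw, as the P-ball is contained in the ball of every P-flip; from dmw one
-- loses a factor of about two, because consecutive partitions differ by one vertex. Hence everything has to be derived
-- from pmw, and polynomial losses in the width are allowed.
--
-- Heredity bounds the VC-dimension: a large shattered set yields a graph in the class containing an affine inner product
-- bipartite graph over 𝔽₂. At the first time a part contains sixteen vertices of one side, four affinely independent ones
-- among them connect a constant fraction of the other side in every flip, which then meets too many parts.
--
-- pmw ⇒ mw: choose in each part of Pₜ up to three vertices at pairwise Pₜ-distance more than 2, maximal as such, and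
-- decreasing in t; let Oₜ be their set. The common refinement of Pₜ and 𝒩 of Oₜ is homogeneous modulo pairs at
-- Pₜ-distance at most 5. A ball contains few elements of Oₜ, and an element of Oₜ outside it cannot distinguish two
-- vertices of the ball in the same part, so the Sauer–Shelah lemma bounds the number of classes in the ball.
--
-- mw ⇒ dmw: choose Oₜ as before, for the distance in Rₜ, and order the vertices compatibly with the Oₜ. For
-- Oₜ₊₁ ⊆ S ⊆ Oₜ, two classes of 𝒩 of S containing far adjacent as well as far non-adjacent pairs are confined to
-- two balls. Hence there is a flip whose balls are covered by polynomially many balls of Rₜ₊₁.
--
-- The partitions in the hypotheses need not be decidable. They are so up to double negation, which suffices for dmw since
-- it is decidable by exhaustive search; mw and tmw are then obtained from the decidable partitions of dmw.

open import Defs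
open import Level using (0ℓ; lift)
open import Data.Bool using (Bool; true; false; _xor_; _∧_; not)
open import Data.Bool.Properties using (xor-assoc; xor-comm; xor-same; xor-identityʳ; ∧-comm; not-¬; not-injective) renaming (_≟_ to _≟B_)
open import Data.Empty using (⊥; ⊥-elim)
open import Data.Fin using (Fin; toℕ; zero; suc; inject≤; fromℕ<; splitAt; join; _↑ˡ_; _↑ʳ_)
open import Data.Fin.Properties using (any?; all?; toℕ-inject≤; injective⇒≤; suc-injective; toℕ-injective; toℕ-fromℕ<; toℕ<n; splitAt-↑ˡ; splitAt-↑ʳ; join-splitAt; ↑ˡ-injective; ↑ʳ-injective) renaming (_≟_ to _≟F_)
open import Data.List using (List; []; _∷_; _++_; length; map; filter; concatMap; take; allFin)
open import Data.List.Membership.Propositional using (_∈_; _∉_; find; lose)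
open import Data.List.Membership.Propositional.Properties using (∈-++⁺ˡ; ∈-++⁺ʳ; ∈-concatMap⁺; ∈-concatMap⁻; ∈-filter⁺; ∈-filter⁻; ∈-map⁺; ∈-map⁻; ∈-allFin; ∈-lookup)
open import Data.List.Properties using (length-++; length-map; length-filter; length-tabulate; filter-++; ++-assoc; ++-identityʳ)
open import Data.List.Relation.Unary.All using (All; []; _∷_) renaming (lookup to All-lookup; tabulate to All-tabulate; map to All-map)
open import Data.List.Relation.Unary.AllPairs using (AllPairs; []; _∷_)
open import Data.List.Relation.Unary.Any using (Any; here; there)
open import Data.List.Relation.Unary.Unique.Propositional using (Unique)
import Data.List.Relation.Unary.All.Properties as Allₚ
import Data.List.Relation.Unary.AllPairs as AllPairs
import Data.List.Relation.Unary.AllPairs.Properties as AllPairsₚ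
import Data.List.Relation.Unary.Any as Any
import Data.List.Relation.Unary.Any.Properties as Anyₚ
import Data.List.Relation.Unary.Unique.Propositional.Properties as Uniqueₚ
open import Data.Nat using (ℕ; zero; suc; _+_; _*_; _^_; _∸_; _⊓_; _≤_; _<_; z≤n; s≤s; _≤?_; pred; >-nonZero)
open import Data.Nat.Properties hiding (suc-injective; _≤?_)
open import Data.Product using (Σ; _×_; ∃; _,_; proj₁; proj₂)
open import Data.Sum using (_⊎_; inj₁; inj₂)
open import Data.Unit using (⊤; tt)
open import Data.Vec using (Vec; []; _∷_; lookup; tabulate; toList)
open import Data.Vec.Properties using (lookup∘tabulate; length-toList; lookup-map; ∷-injectiveʳ) renaming (≡-dec to Vec-≡-dec)
import Data.Vec as Vec
open import Function.Base using (_∘_; case_of_)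
open import Function.Bundles using (_⇔_; mk⇔)
open import Function.Definitions using (Injective)
open import Relation.Binary.Core using (Rel)
open import Relation.Binary.PropositionalEquality using (_≡_; _≢_; refl; trans; cong; cong₂; subst; subst₂) renaming (sym to ≡-sym)
open import Relation.Binary.Structures using (IsEquivalence)
open import Relation.Nullary using (¬_; Dec; yes; no; contradiction)
open import Relation.Nullary.Decidable using (_×-dec_; _→-dec_; ¬?; map′; ⌊_⌋; decidable-stable; ¬¬-excluded-middle)

-- Booleans and decidability

Dec₂ : {n : ℕ} → Rel (Fin n) 0ℓ → Set
Dec₂ P = ∀ x y → Dec (P x y)

xor-≢ : ∀ {a b} → a ≢ b → a xor b ≡ true
xor-≢ {true}  {true}  a≢b = contradiction refl a≢b
xor-≢ {true}  {false} a≢b = refl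
xor-≢ {false} {true}  a≢b = refl
xor-≢ {false} {false} a≢b = contradiction refl a≢b

xor-≡ : ∀ {a b} → a ≡ b → a xor b ≡ false
xor-≡ {true}  refl = refl
xor-≡ {false} refl = refl

xor≡true⇒≢ : ∀ {a b} → a xor b ≡ true → a ≢ b
xor≡true⇒≢ {a} eq refl = contradiction (trans (≡-sym (xor-≡ {a} refl)) eq) λ ()

true≢false : true ≢ false
true≢false ()

≢-≢⇒≡ : ∀ {a b c : Bool} → a ≢ b → c ≢ b → a ≡ c
≢-≢⇒≡ {true}  {b}     {true}  _ _ = refl
≢-≢⇒≡ {false} {b}     {false} _ _ = refl
≢-≢⇒≡ {true}  {true}  {false} p _ = contradiction refl p
≢-≢⇒≡ {true}  {false} {false} _ q = contradiction refl q
≢-≢⇒≡ {false} {true}  {true}  _ q = contradiction refl q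
≢-≢⇒≡ {false} {false} {true}  p _ = contradiction refl p

does-⇔ : {A B : Set} (a? : Dec A) (b? : Dec B) → (A → B) → (B → A) → ⌊ a? ⌋ ≡ ⌊ b? ⌋
does-⇔ (yes _) (yes _) _ _ = refl
does-⇔ (yes a) (no ¬b) f _ = contradiction (f a) ¬b
does-⇔ (no ¬a) (yes b) _ g = contradiction (g b) ¬a
does-⇔ (no _)  (no _)  _ _ = refl

⌊⌋≡true⇒ : {A : Set} (a? : Dec A) → ⌊ a? ⌋ ≡ true → A
⌊⌋≡true⇒ (yes a) _ = a

⇒⌊⌋≡true : {A : Set} (a? : Dec A) → A → ⌊ a? ⌋ ≡ true
⇒⌊⌋≡true (yes _) _ = refl
⇒⌊⌋≡true (no ¬a) a = contradiction a ¬a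

⌊⌋≡false⇒ : {A : Set} (a? : Dec A) → ⌊ a? ⌋ ≡ false → ¬ A
⌊⌋≡false⇒ (no ¬a) _ = ¬a

-- Balls

module _ {n : ℕ} where

  Reach-mono : ∀ {E E′ : Rel (Fin n) 0ℓ} → (∀ {x y} → E x y → E′ x y) → ∀ {r v u} → Reach E r v u → Reach E′ r v u
  Reach-mono f here       = here
  Reach-mono f (step e p) = step (f e) (Reach-mono f p)

  Reach-≤ : ∀ {E : Rel (Fin n) 0ℓ} {r r′ v u} → r ≤ r′ → Reach E r v u → Reach E r′ v u
  Reach-≤ r≤r′       here       = here
  Reach-≤ (s≤s r≤r′) (step e p) = step e (Reach-≤ r≤r′ p)

  Reach-trans : ∀ {E : Rel (Fin n) 0ℓ} {r r′ v w u} → Reach E r v w → Reach E r′ w u → Reach E (r + r′) v u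
  Reach-trans {r = r} here       q = Reach-≤ (m≤n+m _ r) q
  Reach-trans         (step e p) q = step e (Reach-trans p q)

  Reach-sym : ∀ {E : Rel (Fin n) 0ℓ} → (∀ {x y} → E x y → E y x) → ∀ {r v u} → Reach E r v u → Reach E r u v
  Reach-sym s here               = here
  Reach-sym {E} s {u = u} (step {r = r} {v = v} e p) =
    subst (λ k → Reach E k u v) (+-comm r 1) (Reach-trans (Reach-sym s p) (step (s e) here))

  Reach? : ∀ {E : Rel (Fin n) 0ℓ} → Dec₂ E → ∀ r → Dec₂ (Reach E r)
  Reach? E? r v u with v ≟F u
  Reach? E? r       v .v | yes refl = yes here
  Reach? E? zero    v u  | no v≢u   = no λ { here → v≢u refl }
  Reach? E? (suc r) v u  | no v≢u   =
    map′ (λ { (w , e , p) → step e p }) (λ { here → contradiction refl v≢u ; (step e p) → _ , e , p })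
         (any? λ w → E? v w ×-dec Reach? E? r w u)

-- Finite search

-- The counterexample is returned as data: `flipBall-search` turns it into a flip that separates two
-- vertices.
Exhaustible : Set → Set₁
Exhaustible A = {Q : A → Set} → (∀ a → Dec (Q a)) → (∀ a → Q a) ⊎ ∃ λ a → ¬ Q a

exhaust-Bool : Exhaustible Bool
exhaust-Bool Q? with Q? true | Q? false
... | no ¬q | _     = inj₂ (true , ¬q)
... | yes _ | no ¬q = inj₂ (false , ¬q)
... | yes q | yes p = inj₁ λ { true → q ; false → p }

exhaust-Fin : ∀ n → Exhaustible (Fin n)
exhaust-Fin n Q? with any? (¬? ∘ Q?)
... | yes (a , ¬q) = inj₂ (a , ¬q)
... | no ¬∃        = inj₁ λ a → case Q? a of λ { (yes q) → q ; (no ¬q) → contradiction (a , ¬q) ¬∃ }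

exhaust-Vec : ∀ {A} → Exhaustible A → ∀ n → Exhaustible (Vec A n)
exhaust-Vec ex zero Q? with Q? []
... | yes q = inj₁ λ { [] → q }
... | no ¬q = inj₂ ([] , ¬q)
exhaust-Vec ex (suc n) {Q} Q? with ex allTails?
  where
  allTails? : ∀ a → Dec (∀ v → Q (a ∷ v))
  allTails? a with exhaust-Vec ex n (Q? ∘ (a ∷_))
  ... | inj₁ q        = yes q
  ... | inj₂ (v , ¬q) = no λ q → ¬q (q v)
... | inj₁ q = inj₁ λ { (a ∷ v) → q a v }
... | inj₂ (a , ¬q) with exhaust-Vec ex n (Q? ∘ (a ∷_))
...   | inj₁ q        = contradiction q ¬q
...   | inj₂ (v , ¬p) = inj₂ (a ∷ v , ¬p)

exhaust⇒∃? : ∀ {A} → Exhaustible A → {Q : A → Set} → (∀ a → Dec (Q a)) → Dec (∃ Q)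
exhaust⇒∃? ex Q? with ex (¬? ∘ Q?)
... | inj₁ ¬q = no λ { (a , q) → ¬q a q }
... | inj₂ (a , ¬¬q) with Q? a
...   | yes q = yes (a , q)
...   | no ¬q = contradiction ¬q ¬¬q

-- Flips

module _ {n : ℕ} (G : Graph n) where

  GEdge-sym : ∀ {x y} → GEdge G x y → GEdge G y x
  GEdge-sym {x} {y} e = trans (sym G y x) e

  GEdge⇒≢ : ∀ {x y} → GEdge G x y → x ≢ y
  GEdge⇒≢ {x} e refl = true≢false (trans (≡-sym e) (irrefl G x))

  flip : (F : Fin n → Fin n → Bool) → (∀ x y → F x y ≡ F y x) → Graph n
  flip F Fsym = record { adj = a ; sym = a-sym ; irrefl = a-irrefl }
    where
    a : Fin n → Fin n → Bool
    a x y with x ≟F y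
    ... | yes _ = false
    ... | no _  = adj G x y xor F x y
    a-sym : ∀ x y → a x y ≡ a y x
    a-sym x y with x ≟F y | y ≟F x
    ... | yes _   | yes _   = refl
    ... | yes x≡y | no y≢x  = contradiction (≡-sym x≡y) y≢x
    ... | no x≢y  | yes y≡x = contradiction (≡-sym y≡x) x≢y
    ... | no _    | no _    = cong₂ _xor_ (sym G x y) (Fsym x y)
    a-irrefl : ∀ x → a x x ≡ false
    a-irrefl x with x ≟F x
    ... | yes _  = refl
    ... | no x≢x = contradiction refl x≢x

  flip-adj : ∀ F Fsym {x y} → x ≢ y → adj (flip F Fsym) x y ≡ (adj G x y xor F x y)
  flip-adj F Fsym {x} {y} x≢y with x ≟F y
  ... | yes x≡y = contradiction x≡y x≢y
  ... | no _    = refl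

  module _ {P : Rel (Fin n) 0ℓ} (P? : Dec₂ P) where

    private
      -- Flips are searched through vectors of vectors, which are exhaustible; a function `F` is
      -- compared with its tabulation entry by entry.
      Matrix : Set
      Matrix = Vec (Vec Bool n) n

      entry : Matrix → Fin n → Fin n → Bool
      entry M x y = lookup (lookup M x) y

      IsFlipMatrix : Matrix → Set
      IsFlipMatrix M = (∀ x y → entry M x y ≡ entry M y x) ×
        (∀ x x′ y y′ → P x x′ → P y y′ → entry M x y ≡ entry M x′ y′)

      isFlipMatrix? : ∀ M → Dec (IsFlipMatrix M)
      isFlipMatrix? M = (all? λ x → all? λ y → entry M x y ≟B entry M y x) ×-dec
        (all? λ x → all? λ x′ → all? λ y → all? λ y′ →
          P? x x′ →-dec (P? y y′ →-dec (entry M x y ≟B entry M x′ y′)))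

      flipM : ∀ M → IsFlipMatrix M → Graph n
      flipM M (Msym , _) = flip (entry M) Msym

      -- Defined for every matrix, symmetric or not, so that reachability can be decided before the
      -- matrix is known to describe a flip.
      MEdge : Matrix → Rel (Fin n) 0ℓ
      MEdge M x y = x ≢ y × (adj G x y xor entry M x y) ≡ true

      MEdge? : ∀ M → Dec₂ (MEdge M)
      MEdge? M x y = ¬? (x ≟F y) ×-dec ((adj G x y xor entry M x y) ≟B true)

      flipM⇒MEdge : ∀ M fm {x y} → GEdge (flipM M fm) x y → MEdge M x y
      flipM⇒MEdge M fm {x} {y} e with x ≟F y
      ... | yes _   = contradiction e λ ()
      ... | no x≢y  = x≢y , e

    -- There are finitely many `P`-flips, so being outside the ball is witnessed by a single one.
    -- All later arguments about far vertices work inside this flip.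
    flipBall-search : ∀ r v u → FlipBall P G r v u ⊎
      Σ (Graph n) λ G′ → IsFlip P G G′ × ¬ Reach (GEdge G′) r v u
    flipBall-search r v u
      with exhaust-Vec (exhaust-Vec exhaust-Bool n) n
             (λ M → isFlipMatrix? M →-dec Reach? (MEdge? M) r v u)
    ... | inj₂ (M , ¬q) with isFlipMatrix? M
    ...   | no ¬fm = contradiction (λ fm → contradiction fm ¬fm) ¬q
    ...   | yes fm = inj₂ (flipM M fm ,
              (entry M , proj₁ fm , proj₂ fm , λ x y x≢y → flip-adj (entry M) (proj₁ fm) x≢y) ,
              λ p → ¬q λ _ → Reach-mono (flipM⇒MEdge M fm) p)
    flipBall-search r v u | inj₁ q = inj₁ reach
      where
      reach : FlipBall P G r v u
      reach G′ (F , Fsym , Finv , F-adj) = Reach-mono MEdge⇒G′ (q M (Msym , Minv))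
        where
        M : Matrix
        M = tabulate λ x → tabulate λ y → F x y
        M≡F : ∀ x y → entry M x y ≡ F x y
        M≡F x y = trans (cong (λ row → lookup row y) (lookup∘tabulate (λ x → tabulate λ y → F x y) x))
                        (lookup∘tabulate (F x) y)
        Msym : ∀ x y → entry M x y ≡ entry M y x
        Msym x y = trans (M≡F x y) (trans (Fsym x y) (≡-sym (M≡F y x)))
        Minv : ∀ x x′ y y′ → P x x′ → P y y′ → entry M x y ≡ entry M x′ y′
        Minv x x′ y y′ p p′ = trans (M≡F x y) (trans (Finv x x′ y y′ p p′) (≡-sym (M≡F x′ y′)))
        MEdge⇒G′ : ∀ {x y} → MEdge M x y → GEdge G′ x y
        MEdge⇒G′ {x} {y} (x≢y , e) =
          trans (F-adj x y x≢y) (trans (cong (adj G x y xor_) (≡-sym (M≡F x y))) e)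

    flipBall? : ∀ r v u → Dec (FlipBall P G r v u)
    flipBall? r v u with flipBall-search r v u
    ... | inj₁ b               = yes b
    ... | inj₂ (G′ , fl , ¬p) = no λ b → ¬p (b G′ fl)

  module _ {P : Rel (Fin n) 0ℓ} where

    flipBall-≤ : ∀ {r r′ v u} → r ≤ r′ → FlipBall P G r v u → FlipBall P G r′ v u
    flipBall-≤ r≤r′ b G′ fl = Reach-≤ r≤r′ (b G′ fl)

    flipBall-trans : ∀ {r r′ v w u} → FlipBall P G r v w → FlipBall P G r′ w u → FlipBall P G (r + r′) v u
    flipBall-trans b b′ G′ fl = Reach-trans (b G′ fl) (b′ G′ fl)

  -- A flip by the coarser partition is also a flip by the finer one; hence balls grow along a
  -- chain.
  flipBall-coarsen : ∀ {P P′ : Rel (Fin n) 0ℓ} → (∀ {x y} → P x y → P′ x y) →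
    ∀ {r v u} → FlipBall P G r v u → FlipBall P′ G r v u
  flipBall-coarsen P⊆P′ b G′ (F , Fsym , Finv , F-adj) =
    b G′ (F , Fsym , (λ x x′ y y′ p p′ → Finv x x′ y y′ (P⊆P′ p) (P⊆P′ p′)) , F-adj)

flipBall-sym : ∀ {n} (G : Graph n) {P : Rel (Fin n) 0ℓ} {r v u} → FlipBall P G r v u → FlipBall P G r u v
flipBall-sym G b G′ fl = Reach-sym (GEdge-sym G′) (b G′ fl)

module _ {n : ℕ} (G : Graph n) {Q Far : Rel (Fin n) 0ℓ} (Q-equiv : IsEquivalence Q)
  (Q? : Dec₂ Q) (Far? : Dec₂ Far) (Far-sym : ∀ {x y} → Far x y → Far y x) where

  private
    module Q = IsEquivalence Q-equiv

  FarAdj : Rel (Fin n) 0ℓ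
  FarAdj x y = ∃ λ x₁ → ∃ λ y₁ → Q x x₁ × Q y y₁ × Far x₁ y₁ × adj G x₁ y₁ ≡ true

  private
    FarAdj? : Dec₂ FarAdj
    FarAdj? x y = any? λ x₁ → any? λ y₁ → Q? x x₁ ×-dec (Q? y y₁ ×-dec (Far? x₁ y₁ ×-dec (adj G x₁ y₁ ≟B true)))

    FarAdj-sym : ∀ {x y} → FarAdj x y → FarAdj y x
    FarAdj-sym (x₁ , y₁ , p , q , f , e) = y₁ , x₁ , q , p , Far-sym f , GEdge-sym G e

    FarAdj-inv : ∀ {x x′ y y′} → Q x x′ → Q y y′ → FarAdj x y → FarAdj x′ y′
    FarAdj-inv p p′ (x₁ , y₁ , q , q′ , f , e) = x₁ , y₁ , Q.trans (Q.sym p) q , Q.trans (Q.sym p′) q′ , f , e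

    F : Fin n → Fin n → Bool
    F x y = ⌊ FarAdj? x y ⌋

    F-sym : ∀ x y → F x y ≡ F y x
    F-sym x y = does-⇔ (FarAdj? x y) (FarAdj? y x) FarAdj-sym FarAdj-sym

  -- Complements the pairs of classes that contain a far edge. Between classes whose far pairs are
  -- all edges or all non-edges no far edge survives, so far edges remain only between classes with
  -- far pairs of both kinds.
  farFlip : Graph n
  farFlip = flip G F F-sym

  farFlip-isFlip : IsFlip Q G farFlip
  farFlip-isFlip = F , F-sym ,
    (λ x x′ y y′ p p′ → does-⇔ (FarAdj? x y) (FarAdj? x′ y′) (FarAdj-inv p p′) (FarAdj-inv (Q.sym p) (Q.sym p′))) ,
    λ x y x≢y → flip-adj G F F-sym x≢y

  farFlip-edge : ∀ {x y} → Far x y → GEdge farFlip x y → adj G x y ≡ false × FarAdj x y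
  farFlip-edge {x} {y} far e = helper (adj G x y) refl (FarAdj? x y) adj≢F
    where
    adj≢F : adj G x y ≢ F x y
    adj≢F = xor≡true⇒≢ (trans (≡-sym (flip-adj G F F-sym (GEdge⇒≢ farFlip {x} {y} e))) e)
    helper : ∀ a → adj G x y ≡ a → (fa? : Dec (FarAdj x y)) → a ≢ ⌊ fa? ⌋ → a ≡ false × FarAdj x y
    helper true  eq (yes fa) a≢ = contradiction refl a≢
    helper true  eq (no ¬fa) a≢ = contradiction (x , y , Q.refl , Q.refl , far , eq) ¬fa
    helper false eq (yes fa) a≢ = refl , fa
    helper false eq (no ¬fa) a≢ = contradiction refl a≢

-- Covering by few parts

length-concatMap-≤ : {A B : Set} (f : A → List B) {k : ℕ} (xs : List A) → (∀ x → length (f x) ≤ k) →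
  length (concatMap f xs) ≤ length xs * k
length-concatMap-≤ f     []       h = z≤n
length-concatMap-≤ f {k} (x ∷ xs) h = begin
  length (f x ++ concatMap f xs)          ≡⟨ length-++ (f x) ⟩
  length (f x) + length (concatMap f xs)  ≤⟨ +-mono-≤ (h x) (length-concatMap-≤ f xs h) ⟩
  k + length xs * k                       ∎
  where open ≤-Reasoning

∈-concatMap : {A B : Set} (f : A → List B) {x : A} {y : B} {xs : List A} → x ∈ xs → y ∈ f x → y ∈ concatMap f xs
∈-concatMap f x∈xs y∈fx = ∈-concatMap⁺ f (lose x∈xs y∈fx)

module _ {n : ℕ} {P : Rel (Fin n) 0ℓ} where

  PartsLE-≤ : ∀ {X k k′} → k ≤ k′ → PartsLE P X k → PartsLE P X k′
  PartsLE-≤ k≤k′ (L , len , cov) = L , ≤-trans len k≤k′ , cov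

  PartsLE-⊆ : ∀ {X X′ : Fin n → Set} {k} → (∀ {x} → X′ x → X x) → PartsLE P X k → PartsLE P X′ k
  PartsLE-⊆ X′⊆X (L , len , cov) = L , len , λ x x∈X′ → cov x (X′⊆X x∈X′)

PartsLE-coarsen : ∀ {n} {P P′ : Rel (Fin n) 0ℓ} → (∀ {x y} → P x y → P′ x y) →
  ∀ {X k} → PartsLE P X k → PartsLE P′ X k
PartsLE-coarsen P⊆P′ (L , len , cov) = L , len , λ x x∈X → Any.map P⊆P′ (cov x x∈X)

-- The Sauer–Shelah lemma

module _ {n : ℕ} (G : Graph n) where

  SameTrace : List (Fin n) → Rel (Fin n) 0ℓ
  SameTrace T x y = ∀ s → s ∈ T → adj G x s ≡ adj G y s

  sameTrace? : ∀ T → Dec₂ (SameTrace T)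
  sameTrace? []      x y = yes λ _ ()
  sameTrace? (s ∷ T) x y = map′
    (λ { (eq , same) → λ { _ (here refl) → eq ; u (there u∈T) → same u u∈T } })
    (λ same → same s (here refl) , λ u u∈T → same u (there u∈T))
    ((adj G x s ≟B adj G y s) ×-dec sameTrace? T x y)

  Shatters : (Fin n → Set) → ∀ {d} → Vec (Fin n) d → Set
  Shatters Y T = ∀ b → ∃ λ x → Y x × Vec.map (adj G x) T ≡ b

  map-adj-cong : ∀ {T d} (T′ : Vec (Fin n) d) → (∀ i → lookup T′ i ∈ T) → ∀ {x y} → SameTrace T x y →
    Vec.map (adj G x) T′ ≡ Vec.map (adj G y) T′
  map-adj-cong []       sub same = refl
  map-adj-cong (s ∷ T′) sub same = cong₂ _∷_ (same s (sub zero)) (map-adj-cong T′ (sub ∘ suc) same)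

  -- The representatives stay in `Y`: in the induction below a vertex and its representative may
  -- become the two partners in `Both`.
  TraceCover : List (Fin n) → (Fin n → Set) → ℕ → Set
  TraceCover T Y k = Σ (List (Fin n)) λ L → All Y L × length L ≤ k × (∀ x → Y x → Any (SameTrace T x) L)

  -- The cover for s ∷ T consists of the cover for T together with, for each trace on T that extends
  -- in both ways, two vertices realising both extensions.
  sauer-shelah : ∀ d T {Y : Fin n → Set} → (∀ x → Dec (Y x)) →
    (Σ (Vec (Fin n) d) λ T′ → (∀ i → lookup T′ i ∈ T) × Shatters Y T′) ⊎
    TraceCover T Y (suc (2 * length T) ^ d)
  sauer-shelah zero T Y? with any? Y?
  ... | yes (x , y) = inj₁ ([] , (λ ()) , λ { [] → x , y , refl })
  ... | no ¬y       = inj₂ ([] , [] , z≤n , λ x y → contradiction (x , y) ¬y)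
  sauer-shelah (suc d) [] Y? with any? Y?
  ... | yes (x , y) = inj₂ (x ∷ [] , y ∷ [] , ≤-reflexive (≡-sym (^-zeroˡ (suc d))) , λ _ _ → here λ _ ())
  ... | no ¬y       = inj₂ ([] , [] , z≤n , λ x y → contradiction (x , y) ¬y)
  sauer-shelah (suc d) (s ∷ T) {Y} Y? = combine (sauer-shelah (suc d) T Y?) (sauer-shelah d T Both?)
    where
    Partner : Rel (Fin n) 0ℓ
    Partner x x′ = Y x′ × SameTrace T x x′ × adj G x s ≢ adj G x′ s

    Both : Fin n → Set
    Both x = Y x × ∃ (Partner x)

    Both? : ∀ x → Dec (Both x)
    Both? x = Y? x ×-dec any? λ x′ → Y? x′ ×-dec (sameTrace? T x x′ ×-dec ¬? (adj G x s ≟B adj G x′ s))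

    pairs : ∀ {L} → All Both L → List (Fin n)
    pairs {[]}    []                   = []
    pairs {x ∷ L} ((_ , x′ , _) ∷ bs) = x ∷ x′ ∷ pairs bs

    pairs-Y : ∀ {L} (bs : All Both L) → All Y (pairs bs)
    pairs-Y []                        = []
    pairs-Y ((y , _ , y′ , _) ∷ bs) = y ∷ y′ ∷ pairs-Y bs

    pairs-length : ∀ {L} (bs : All Both L) → length (pairs bs) ≡ length L * 2
    pairs-length []       = refl
    pairs-length (_ ∷ bs) = cong (2 +_) (pairs-length bs)

    extend : ∀ {x y} → adj G x s ≡ adj G y s → SameTrace T x y → SameTrace (s ∷ T) x y
    extend eq same _ (here refl) = eq
    extend eq same u (there u∈T) = same u u∈T

    pairs-cover : ∀ {L x} (bs : All Both L) → Any (SameTrace T x) L → Any (SameTrace (s ∷ T) x) (pairs bs)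
    pairs-cover {z ∷ L} {x} ((_ , z′ , _ , zz′ , z≢z′) ∷ bs) (here xz) with adj G x s ≟B adj G z s
    ... | yes eq = here (extend eq xz)
    ... | no x≢z = there (here (extend (≢-≢⇒≡ x≢z (z≢z′ ∘ ≡-sym)) λ u u∈T → trans (xz u u∈T) (zz′ u u∈T)))
    pairs-cover (_ ∷ bs) (there xL) = there (there (pairs-cover bs xL))

    combine : _ → _ → _
    combine (inj₁ (T′ , sub , sh)) _ = inj₁ (T′ , there ∘ sub , sh)
    combine _ (inj₁ (T′ , sub , sh)) = inj₁ (s ∷ T′ , (λ { zero → here refl ; (suc i) → there (sub i) }) , shat)
      where
      shat : Shatters Y (s ∷ T′)
      shat (b ∷ bs) with sh bs
      ... | x , (y , x′ , y′ , same , ≢) , eq with adj G x s ≟B b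
      ...   | yes p = x , y , cong₂ _∷_ p eq
      ...   | no ¬p = x′ , y′ , cong₂ _∷_ (≢-≢⇒≡ (≢ ∘ ≡-sym) (¬p ∘ ≡-sym)) (trans (≡-sym (map-adj-cong T′ sub same)) eq)
    combine (inj₂ (L , yL , len , cov)) (inj₂ (M , bM , lenM , covM)) =
      inj₂ (L ++ pairs bM , Allₚ.++⁺ yL (pairs-Y bM) , bound , cover)
      where
      a : ℕ
      a = suc (2 * length T)
      a≤ : a ≤ suc (2 * suc (length T))
      a≤ = s≤s (*-monoʳ-≤ 2 (n≤1+n (length T)))
      a+2≡ : a + 2 ≡ suc (2 * suc (length T))
      a+2≡ = cong suc (trans (+-comm (2 * length T) 2) (≡-sym (*-suc 2 (length T))))
      bound : length (L ++ pairs bM) ≤ suc (2 * suc (length T)) ^ suc d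
      bound = begin
        length (L ++ pairs bM)                   ≡⟨ length-++ L ⟩
        length L + length (pairs bM)             ≡⟨ cong (length L +_) (pairs-length bM) ⟩
        length L + length M * 2                  ≤⟨ +-mono-≤ len (*-monoˡ-≤ 2 lenM) ⟩
        a * a ^ d + a ^ d * 2                    ≡⟨ cong (a * a ^ d +_) (*-comm (a ^ d) 2) ⟩
        a * a ^ d + 2 * a ^ d                    ≡⟨ *-distribʳ-+ (a ^ d) a 2 ⟨
        (a + 2) * a ^ d                          ≡⟨ cong (_* a ^ d) a+2≡ ⟩
        suc (2 * suc (length T)) * a ^ d         ≤⟨ *-monoʳ-≤ (suc (2 * suc (length T))) (^-monoˡ-≤ d a≤) ⟩
        suc (2 * suc (length T)) ^ suc d         ∎
        where open ≤-Reasoning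
      cover : ∀ x → Y x → Any (SameTrace (s ∷ T) x) (L ++ pairs bM)
      cover x y with find (cov x y)
      ... | z , z∈L , same with adj G x s ≟B adj G z s
      ...   | yes eq = Anyₚ.++⁺ˡ (lose z∈L (extend eq same))
      ...   | no ≢   = Anyₚ.++⁺ʳ L (pairs-cover bM (covM x (y , z , All-lookup yL z∈L , same , ≢)))

  -- The shattering vertices lie outside a set containing the shattered ones, so a violation yields
  -- a bipartite pattern with disjoint sides.
  NoShatter : ℕ → Set₁
  NoShatter d = ∀ {Y S : Fin n → Set} (T : Vec (Fin n) d) →
    (∀ i → S (lookup T i)) → (∀ x → Y x → ¬ S x) → ¬ Shatters Y T

-- Counting the classes of NS in a set meeting few parts

NS-isEquivalence : ∀ {n} (G : Graph n) (S : Fin n → Set) → IsEquivalence (NS G S)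
NS-isEquivalence G S = record
  { refl  = inj₁ refl
  ; sym   = λ { (inj₁ eq) → inj₁ (≡-sym eq) ; (inj₂ (¬u , ¬v , same)) → inj₂ (¬v , ¬u , λ w s → ≡-sym (same w s)) }
  ; trans = λ { (inj₁ refl) q → q ; p (inj₁ refl) → p
              ; (inj₂ (¬u , _ , same)) (inj₂ (_ , ¬w , same′)) → inj₂ (¬u , ¬w , λ z s → trans (same z s) (same′ z s)) }
  }

module _ {n : ℕ} (G : Graph n) where

  NS? : ∀ {S : Fin n → Set} → (∀ x → Dec (S x)) → Dec₂ (NS G S)
  NS? S? u v with u ≟F v
  ... | yes eq = yes (inj₁ eq)
  ... | no u≢v = map′ inj₂ (λ { (inj₁ eq) → contradiction eq u≢v ; (inj₂ p) → p })
    (¬? (S? u) ×-dec (¬? (S? v) ×-dec all? λ w → S? w →-dec (adj G u w ≟B adj G v w)))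

  NS-adj : ∀ {S : Fin n → Set} {u v w} → NS G S u v → S w → adj G u w ≡ adj G v w
  NS-adj (inj₁ refl)           _ = refl
  NS-adj (inj₂ (_ , _ , same)) s = same _ s

  NS-antitone : ∀ {S S′ : Fin n → Set} → (∀ {w} → S′ w → S w) → ∀ {u v} → NS G S u v → NS G S′ u v
  NS-antitone S′⊆S (inj₁ eq)              = inj₁ eq
  NS-antitone S′⊆S (inj₂ (¬u , ¬v , same)) = inj₂ (¬u ∘ S′⊆S , ¬v ∘ S′⊆S , λ w s → same w (S′⊆S s))

  NS-∈ : ∀ {S : Fin n → Set} {u v} → NS G S u v → S u → u ≡ v
  NS-∈ (inj₁ eq)       _ = eq
  NS-∈ (inj₂ (¬u , _)) s = contradiction s ¬u

-- For `k` parts with at most three elements of `S` each: first these elements themselves, then in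
-- every part the Sauer-Shelah bound for traces on them.
classBound : ℕ → ℕ → ℕ
classBound d k = k * 3 + k * suc (2 * (k * 3)) ^ d

module _ {n : ℕ} (G : Graph n) {d : ℕ} (noShatter : NoShatter G d)
  {P : Rel (Fin n) 0ℓ} (P? : Dec₂ P) (P-equiv : IsEquivalence P)
  {S X : Fin n → Set} (S? : ∀ x → Dec (S x)) (X? : ∀ x → Dec (X x)) where

  private
    module P = IsEquivalence P-equiv

    Y : Fin n → Fin n → Set
    Y y x = X x × ¬ S x × P x y

    Y? : ∀ y x → Dec (Y y x)
    Y? y x = X? x ×-dec (¬? (S? x) ×-dec P? x y)

  -- Inside one part, the class of a vertex of `X` outside `S` is determined by its trace on `T`,
  -- because the elements of `S` outside `T` do not distinguish vertices of `X` in the same part.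
  classes-≤ : ∀ {k} T → All S T → length T ≤ k * 3 →
    (∀ {x} → X x → S x → x ∈ T) →
    (∀ {x x′ s} → X x → X x′ → P x x′ → S s → s ∉ T → adj G x s ≡ adj G x′ s) →
    PartsLE P X k → PartsLE (λ x y → P x y × NS G S x y) X (classBound d k)
  classes-≤ {k} T T⊆S T≤ X∩S⊆T far (Ly , Ly≤ , Ly-cov) = T ++ concatMap reps Ly , bound , cover
    where
    traces : ∀ y → TraceCover G T (Y y) (suc (2 * length T) ^ d)
    traces y with sauer-shelah G d T (Y? y)
    ... | inj₂ c = c
    ... | inj₁ (T′ , sub , sh) =
      contradiction sh (noShatter T′ (λ i → All-lookup T⊆S (sub i)) λ x (_ , ¬s , _) → ¬s)
    reps : Fin n → List (Fin n)
    reps y = proj₁ (traces y)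
    bound : length (T ++ concatMap reps Ly) ≤ classBound d k
    bound = begin
      length (T ++ concatMap reps Ly)                      ≡⟨ length-++ T ⟩
      length T + length (concatMap reps Ly)                ≤⟨ +-mono-≤ T≤ (length-concatMap-≤ reps Ly λ y → proj₁ (proj₂ (proj₂ (traces y)))) ⟩
      k * 3 + length Ly * suc (2 * length T) ^ d           ≤⟨ +-monoʳ-≤ (k * 3) (*-mono-≤ Ly≤ (^-monoˡ-≤ d (s≤s (*-monoʳ-≤ 2 T≤)))) ⟩
      classBound d k                                       ∎
      where open ≤-Reasoning
    cover : ∀ x → X x → Any (λ y → P x y × NS G S x y) (T ++ concatMap reps Ly)
    cover x x∈X with S? x
    ... | yes s = Anyₚ.++⁺ˡ (lose (X∩S⊆T x∈X s) (P.refl , inj₁ refl))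
    ... | no ¬s with find (Ly-cov x x∈X)
    ...   | y , y∈Ly , xy with proj₂ (proj₂ (proj₂ (traces y))) x (x∈X , ¬s , xy)
    ...     | same with find same
    ...       | z , z∈ , xz with All-lookup (proj₁ (proj₂ (traces y))) z∈
    ...         | z∈X , ¬sz , zy = Anyₚ.++⁺ʳ T (lose (∈-concatMap reps y∈Ly z∈) (Pxz , inj₂ (¬s , ¬sz , agree)))
      where
      Pxz : P x z
      Pxz = P.trans xy (P.sym zy)
      agree : ∀ w → S w → adj G x w ≡ adj G z w
      agree w sw with Any.any? (w ≟F_) T
      ... | yes w∈T = xz w w∈T
      ... | no w∉T  = far x∈X z∈X Pxz sw w∉T

-- Nets: sets with at most three, pairwise non-close, elements in each part, and maximal as such

length-filter-⊆ : {A : Set} {P Q : A → Set} (P? : ∀ x → Dec (P x)) (Q? : ∀ x → Dec (Q x)) →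
  (∀ {x} → P x → Q x) → ∀ xs → length (filter P? xs) ≤ length (filter Q? xs)
length-filter-⊆ P? Q? P⊆Q [] = z≤n
length-filter-⊆ P? Q? P⊆Q (x ∷ xs) with P? x | Q? x
... | yes _ | yes _ = s≤s (length-filter-⊆ P? Q? P⊆Q xs)
... | yes p | no ¬q = contradiction (P⊆Q p) ¬q
... | no _  | yes _ = m≤n⇒m≤1+n (length-filter-⊆ P? Q? P⊆Q xs)
... | no _  | no _  = length-filter-⊆ P? Q? P⊆Q xs

module _ {n : ℕ} where

  record Sparse {P : Rel (Fin n) 0ℓ} (P? : Dec₂ P) (Close : Rel (Fin n) 0ℓ) (O : List (Fin n)) : Set where
    field
      separated : AllPairs (λ s s′ → P s s′ → ¬ Close s s′) O
      few       : ∀ v → length (filter (P? v) O) ≤ 3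

  -- Three elements are asked for because in each use two vertices can spoil at most one of them
  -- each, by their being pairwise non-close.
  Near Wide : Rel (Fin n) 0ℓ → Rel (Fin n) 0ℓ → List (Fin n) → Fin n → Set
  Near P Close O v = ∃ λ s → s ∈ O × P v s × Close v s
  Wide P Close O v = ∃ λ s₁ → ∃ λ s₂ → ∃ λ s₃ →
    (s₁ ∈ O × P v s₁) × (s₂ ∈ O × P v s₂) × (s₃ ∈ O × P v s₃) ×
    ¬ Close s₁ s₂ × ¬ Close s₁ s₃ × ¬ Close s₂ s₃

  record Net {P : Rel (Fin n) 0ℓ} (P? : Dec₂ P) (Close : Rel (Fin n) 0ℓ) (O : List (Fin n)) : Set where
    field
      sparse : Sparse P? Close O
      dense  : ∀ v → Near P Close O v ⊎ Wide P Close O v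
    open Sparse sparse public

    partMembers : Fin n → List (Fin n)
    partMembers v = filter (P? v) O

  sparse-[] : ∀ {P Close : Rel (Fin n) 0ℓ} {P? : Dec₂ P} → Sparse P? Close []
  sparse-[] = record { separated = [] ; few = λ _ → z≤n }

  -- Lets the net of a coarse partition serve as the start of the net of a finer one.
  sparse-refine : ∀ {P P′ Close Close′ : Rel (Fin n) 0ℓ} {P? : Dec₂ P} {P′? : Dec₂ P′} {O} →
    (∀ {x y} → P′ x y → P x y) → (∀ {x y} → Close′ x y → Close x y) → Sparse P? Close O → Sparse P′? Close′ O
  sparse-refine {P? = P?} {P′?} {O} P′⊆P C′⊆C sp = record
    { separated = AllPairs.map (λ far p c → far (P′⊆P p) (C′⊆C c)) separated
    ; few       = λ v → ≤-trans (length-filter-⊆ (P′? v) (P? v) P′⊆P O) (few v)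
    }
    where open Sparse sp

  module _ {P Close : Rel (Fin n) 0ℓ} (P? : Dec₂ P) (Close? : Dec₂ Close) (P-equiv : IsEquivalence P)
    (Close-refl : ∀ {x} → Close x x) (Close-sym : ∀ {x y} → Close x y → Close y x) where

    private
      module P = IsEquivalence P-equiv

      Dense : List (Fin n) → Fin n → Set
      Dense O v = Near P Close O v ⊎ Wide P Close O v

      dense-++ : ∀ {O} X {v} → Dense O v → Dense (O ++ X) v
      dense-++ X (inj₁ (s , s∈O , pc)) = inj₁ (s , ∈-++⁺ˡ s∈O , pc)
      dense-++ X (inj₂ (s₁ , s₂ , s₃ , (m₁ , p₁) , (m₂ , p₂) , (m₃ , p₃) , far)) =
        inj₂ (s₁ , s₂ , s₃ , (∈-++⁺ˡ m₁ , p₁) , (∈-++⁺ˡ m₂ , p₂) , (∈-++⁺ˡ m₃ , p₃) , far)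

      wide : ∀ {O v} → Sparse P? Close O → 3 ≤ length (filter (P? v) O) → Wide P Close O v
      wide {O} {v} sp 3≤ = go (filter (P? v) O) (λ m → ∈-filter⁻ (P? v) m)
          (AllPairsₚ.filter⁺ (P? v) (Sparse.separated sp)) 3≤
        where
        go : ∀ xs → (∀ {s} → s ∈ xs → s ∈ O × P v s) → AllPairs (λ s s′ → P s s′ → ¬ Close s s′) xs →
          3 ≤ length xs → Wide P Close O v
        go (s₁ ∷ s₂ ∷ s₃ ∷ _) mem ((f₁₂ ∷ f₁₃ ∷ _) ∷ (f₂₃ ∷ _) ∷ _) _ =
          s₁ , s₂ , s₃ , m₁ , m₂ , m₃ ,
          f₁₂ (P.trans (P.sym (proj₂ m₁)) (proj₂ m₂)) ,
          f₁₃ (P.trans (P.sym (proj₂ m₁)) (proj₂ m₃)) ,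
          f₂₃ (P.trans (P.sym (proj₂ m₂)) (proj₂ m₃))
          where
          m₁ = mem (here refl)
          m₂ = mem (there (here refl))
          m₃ = mem (there (there (here refl)))
        go (_ ∷ [])     _ _ (s≤s ())
        go (_ ∷ _ ∷ []) _ _ (s≤s (s≤s ()))

      add : ∀ {O} v → Sparse P? Close O → ∃ λ X → Sparse P? Close (O ++ X) × Dense (O ++ X) v
      add {O} v sp with any? (λ s → Any.any? (s ≟F_) O ×-dec (P? v s ×-dec Close? v s))
      ... | yes near = [] , subst (λ L → Sparse P? Close L × Dense L v) (≡-sym (++-identityʳ O)) (sp , inj₁ near)
      ... | no ¬near with 3 ≤? length (filter (P? v) O)
      ...   | yes 3≤ = [] , subst (λ L → Sparse P? Close L × Dense L v) (≡-sym (++-identityʳ O)) (sp , inj₂ (wide sp 3≤))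
      ...   | no ¬3≤ = v ∷ [] , sparse′ , inj₁ (v , ∈-++⁺ʳ O (here refl) , P.refl , Close-refl)
        where
        sparse′ : Sparse P? Close (O ++ v ∷ [])
        sparse′ = record
          { separated = AllPairsₚ.++⁺ (Sparse.separated sp) ([] ∷ [])
              (All-tabulate λ {s} s∈O → (λ p c → ¬near (s , s∈O , P.sym p , Close-sym c)) ∷ [])
          ; few = few′ }
          where
          few′ : ∀ u → length (filter (P? u) (O ++ v ∷ [])) ≤ 3
          few′ u = ≤-trans (≤-reflexive (trans (cong length (filter-++ (P? u) O (v ∷ []))) (length-++ (filter (P? u) O)))) bound
            where
            bound : length (filter (P? u) O) + length (filter (P? u) (v ∷ [])) ≤ 3
            bound with P? u v
            ... | no _  = ≤-trans (≤-reflexive (+-identityʳ _)) (Sparse.few sp u)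
            ... | yes p = ≤-trans (≤-reflexive (+-comm _ 1))
                (≤-trans (s≤s (length-filter-⊆ (P? u) (P? v) (P.trans (P.sym p)) O)) (≰⇒> ¬3≤))

      addAll : ∀ vs {O} → Sparse P? Close O → ∃ λ X → Sparse P? Close (O ++ X) × All (Dense (O ++ X)) vs
      addAll [] {O} sp = [] , subst (Sparse P? Close) (≡-sym (++-identityʳ O)) sp , []
      addAll (v ∷ vs) {O} sp with add v sp
      ... | X , sp₁ , d with addAll vs sp₁
      ...   | X′ , sp₂ , ds = X ++ X′ ,
        subst (λ L → Sparse P? Close L × All (Dense L) (v ∷ vs)) (++-assoc O X X′) (sp₂ , dense-++ X′ d ∷ ds)

    -- Vertices are tried one after the other and added where possible; a vertex once dense stays so
    -- when the set grows.
    net-extend : ∀ {O} → Sparse P? Close O → ∃ λ X → Net P? Close (O ++ X)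
    net-extend sp with addAll (allFin n) sp
    ... | X , sp′ , ds = X , record { sparse = sp′ ; dense = λ v → All-lookup ds (∈-allFin v) }

-- Nets along a chain

DecChain : ∀ {n} → Chain n → Set
DecChain c = ∀ t → Dec₂ (P c t)

coarse-pred : ∀ {n} (c : Chain n) t → t ≤ m c → ∀ {x y} → P c (pred t) x y → P c t x y
coarse-pred c zero    _   p = p
coarse-pred c (suc t) t<m p = coarse c t t<m _ _ p

module _ {n : ℕ} (c : Chain n) (P? : DecChain c) {Close : ℕ → Rel (Fin n) 0ℓ}
  (Close? : ∀ t → Dec₂ (Close t)) (Close-refl : ∀ t {x} → Close t x x)
  (Close-sym : ∀ t → t ≤ m c → ∀ {x y} → Close t x y → Close t y x)
  (Close-mono : ∀ t → t < m c → ∀ {x y} → Close t x y → Close (suc t) x y) where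

  -- The nets are nested as prefixes and not just as sets, so that the list `O 0` orders vertices
  -- with every `O t` an initial segment.
  record NetSeq : Set where
    field
      O      : ℕ → List (Fin n)
      net    : ∀ t → t ≤ m c → Net (P? t) (Close t) (O t)
      nested : ∀ t → t < m c → ∃ λ X → O t ≡ O (suc t) ++ X

  private
    -- The construction runs backwards, from the coarsest partition at `j = 0`. Truncated
    -- subtraction keeps it at the finest one afterwards, which matches `pred` in `coarse-pred`.
    level : ℕ → ℕ
    level j = m c ∸ j

    level≤ : ∀ j → level j ≤ m c
    level≤ j = m∸n≤m (m c) j

    close-pred : ∀ t → t ≤ m c → ∀ {x y} → Close (pred t) x y → Close t x y
    close-pred zero    _   p = p
    close-pred (suc t) t<m p = Close-mono t t<m p

    NetAt : ℕ → List (Fin n) → Set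
    NetAt t = Net (P? t) (Close t)

    extendAt : ∀ t → t ≤ m c → ∀ {O} → Sparse (P? t) (Close t) O → ∃ λ X → NetAt t (O ++ X)
    extendAt t t≤m = net-extend (P? t) (Close? t) (equiv c t t≤m) (Close-refl t) (Close-sym t t≤m)

    build   : ∀ j → ∃ (NetAt (level j))
    growth  : ∀ j → ∃ λ X → NetAt (level (suc j)) (proj₁ (build j) ++ X)

    build zero = extendAt (m c) ≤-refl sparse-[]
    build (suc j) = proj₁ (build j) ++ proj₁ (growth j) , proj₂ (growth j)

    growth j = extendAt (level (suc j)) (level≤ (suc j))
      (subst (λ t → Sparse (P? t) (Close t) (proj₁ (build j))) (pred[m∸n]≡m∸[1+n] (m c) j)
        (sparse-refine (coarse-pred c (level j) (level≤ j)) (close-pred (level j) (level≤ j))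
          (Net.sparse (proj₂ (build j)))))

  netSeq : NetSeq
  netSeq = record
    { O      = λ t → proj₁ (build (level t))
    ; net    = λ t t≤m → subst (λ u → NetAt u (proj₁ (build (level t)))) (m∸[m∸n]≡n t≤m) (proj₂ (build (level t)))
    ; nested = λ t t<m → subst (λ j → ∃ λ X → proj₁ (build j) ≡ proj₁ (build (level (suc t))) ++ X)
                 (≡-sym (∸-suc′ t<m)) (proj₁ (growth (level (suc t))) , refl)
    }
    where
    ∸-suc′ : ∀ {t} → t < m c → level t ≡ suc (level (suc t))
    ∸-suc′ {t} t<m = +-∸-assoc 1 t<m

-- From partition to merge sequences

pigeonhole₃ : {A₁ A₂ A₃ B₁ B₂ B₃ : Set} →
  (A₁ → A₂ → ⊥) → (A₁ → A₃ → ⊥) → (A₂ → A₃ → ⊥) → (B₁ → B₂ → ⊥) → (B₁ → B₃ → ⊥) → (B₂ → B₃ → ⊥) →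
  A₁ ⊎ B₁ → A₂ ⊎ B₂ → A₃ ⊎ B₃ → ⊥
pigeonhole₃ a₁₂ a₁₃ a₂₃ b₁₂ b₁₃ b₂₃ (inj₁ p) (inj₁ q) _        = a₁₂ p q
pigeonhole₃ a₁₂ a₁₃ a₂₃ b₁₂ b₁₃ b₂₃ (inj₂ p) (inj₂ q) _        = b₁₂ p q
pigeonhole₃ a₁₂ a₁₃ a₂₃ b₁₂ b₁₃ b₂₃ (inj₁ p) (inj₂ _) (inj₁ q) = a₁₃ p q
pigeonhole₃ a₁₂ a₁₃ a₂₃ b₁₂ b₁₃ b₂₃ (inj₂ p) (inj₁ _) (inj₂ q) = b₁₃ p q
pigeonhole₃ a₁₂ a₁₃ a₂₃ b₁₂ b₁₃ b₂₃ (inj₂ _) (inj₁ p) (inj₁ q) = a₂₃ p q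
pigeonhole₃ a₁₂ a₁₃ a₂₃ b₁₂ b₁₃ b₂₃ (inj₁ _) (inj₂ p) (inj₂ q) = b₂₃ p q

module _ {n : ℕ} (G : Graph n) {P : Rel (Fin n) 0ℓ} (P? : Dec₂ P) (P-equiv : IsEquivalence P) where

  private
    module P = IsEquivalence P-equiv

    B : ℕ → Rel (Fin n) 0ℓ
    B = FlipBall P G

  separating-flip : ∀ {r x y} → ¬ B r x y → Σ (Graph n) λ G′ → Σ Bool λ b → IsFlip P G G′ × ¬ Reach (GEdge G′) r x y ×
    (∀ {p q} → P x p → P y q → p ≢ q → adj G p q ≢ b → GEdge G′ p q)
  separating-flip {r} {x} {y} ¬B with flipBall-search G P? r x y
  ... | inj₁ B′ = contradiction B′ ¬B
  ... | inj₂ (G′ , fl@(F , _ , Finv , F-adj) , ¬reach) = G′ , F x y , fl , ¬reach , λ {p} {q} xp yq p≢q ne →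
        trans (F-adj p q p≢q) (trans (cong (adj G p q xor_) (≡-sym (Finv x p y q xp yq))) (xor-≢ ne))

  -- The flip bit between the two parts must be `adj G x y`, as otherwise `x` and `y` would be
  -- adjacent in the separating flip.
  separating-flip-far : ∀ {r x y} → x ≢ y → ¬ B (suc r) x y → Σ (Graph n) λ G′ → IsFlip P G G′ × ¬ Reach (GEdge G′) (suc r) x y ×
    (∀ {p q} → P x p → P y q → p ≢ q → adj G p q ≢ adj G x y → GEdge G′ p q)
  separating-flip-far {r} {x} {y} x≢y ¬B with separating-flip ¬B
  ... | G′ , b , fl , ¬reach , edge with adj G x y ≟B b
  ...   | yes refl = G′ , fl , ¬reach , edge
  ...   | no ≢b    = contradiction (step (edge P.refl P.refl x≢y ≢b) here) ¬reach

  -- If `s` saw `y` differently, it would be joined to `y` in the flip separating `x` from `y`, and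
  -- `x` would reach `y` through `s`.
  near-adj : ∀ {r ρ x y s} → x ≢ y → ρ ≤ r → ¬ B (suc r) x y → P x s → B ρ x s → s ≢ y → adj G s y ≡ adj G x y
  near-adj {r} {ρ} {x} {y} {s} x≢y ρ≤r ¬B xs Bxs s≢y with adj G s y ≟B adj G x y
  ... | yes eq = eq
  ... | no ne with separating-flip-far x≢y ¬B
  ...   | G′ , fl , ¬reach , edge = contradiction
    (Reach-≤ (≤-trans (≤-reflexive (+-comm ρ 1)) (s≤s ρ≤r)) (Reach-trans (Bxs G′ fl) (step (edge xs P.refl s≢y ne) here))) ¬reach

  -- A flip separating s₁ from s₂ complements their part against that of y and z exactly when y is a common
  -- neighbour, and exactly when z is.
  common-adj : ∀ {s₁ s₂ y z} → P s₁ s₂ → ¬ B 2 s₁ s₂ → P y z → s₁ ≢ y → s₂ ≢ y → s₁ ≢ z → s₂ ≢ z →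
    adj G s₁ y ≡ adj G s₂ y → adj G s₁ z ≡ adj G s₂ z → adj G s₁ z ≡ adj G s₁ y
  common-adj {s₁} {s₂} {y} {z} s₁s₂ ¬B yz s₁y s₂y s₁z s₂z eqy eqz with flipBall-search G P? 2 s₁ s₂
  ... | inj₁ b = contradiction b ¬B
  ... | inj₂ (G′ , (F , Fsym , Finv , F-adj) , ¬reach) =
      trans (no-common yz s₁z s₂z eqz) (≡-sym (no-common P.refl s₁y s₂y eqy))
    where
    edge : ∀ {s w} → P s₁ s → P y w → s ≢ w → adj G s w ≢ F s₁ y → GEdge G′ s w
    edge {s} {w} p q s≢w ne = trans (F-adj s w s≢w) (trans (cong (adj G s w xor_) (≡-sym (Finv s₁ s y w p q))) (xor-≢ ne))
    no-common : ∀ {w} → P y w → s₁ ≢ w → s₂ ≢ w → adj G s₁ w ≡ adj G s₂ w → adj G s₁ w ≡ F s₁ y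
    no-common {w} yw s₁w s₂w eq with adj G s₁ w ≟B F s₁ y
    ... | yes e = e
    ... | no ne = contradiction
      (step (edge P.refl yw s₁w ne)
        (step (GEdge-sym G′ (edge s₁s₂ yw s₂w (λ e → ne (trans eq e)))) here)) ¬reach

  module _ {O : List (Fin n)} (net : Net P? (B 2) O) where

    open Net net using (dense)

    private
      Twin : Rel (Fin n) 0ℓ
      Twin = NS G (_∈ O)

      ∈-∉⇒≢ : ∀ {s x} → s ∈ O → x ∉ O → s ≢ x
      ∈-∉⇒≢ s∈ x∉ refl = x∉ s∈

      module _ {x y x′ y′ : Fin n} (x∉ : x ∉ O) (y∉ : y ∉ O) (x′∉ : x′ ∉ O) (y′∉ : y′ ∉ O)
        (xx′ : P x x′) (yy′ : P y y′) (tx : Twin x x′) (ty : Twin y y′) (x≢y : x ≢ y) (x′≢y′ : x′ ≢ y′)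
        (far : ¬ B 5 x y) (far′ : ¬ B 5 x′ y′) (differ : adj G x y ≢ adj G x′ y′) where

        adj-twin : ∀ {s} → s ∈ O → adj G s y ≡ adj G s y′
        adj-twin {s} s∈ = trans (sym G s y) (trans (NS-adj G ty s∈) (sym G y′ s))

        -- In the flip separating `x′` from `y′`, pairs between their parts whose adjacency differs
        -- from `adj G x′ y′` are edges. So `x′`, `a`, `x`, `y`, `s`, `y′` is a path, and its length
        -- is the 5 in the definition of far pairs.
        path : ∀ {s a} → s ∈ O → P x s → a ∈ O → P y a → adj G s y ≢ adj G x′ y′ → adj G x a ≢ adj G x′ y′ → ⊥
        path {s} {a} s∈ xs a∈ ya ns na with separating-flip-far x′≢y′ far′
        ... | G′ , fl , ¬reach , edge = ¬reach
          (step (edge P.refl y′a (∈-∉⇒≢ a∈ x′∉ ∘ ≡-sym) λ e → na (trans (NS-adj G tx a∈) e))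
          (step (GEdge-sym G′ (edge x′x y′a (∈-∉⇒≢ a∈ x∉ ∘ ≡-sym) na))
          (step (edge x′x y′y x≢y differ)
          (step (GEdge-sym G′ (edge x′s y′y (∈-∉⇒≢ s∈ y∉) ns))
          (step (edge x′s P.refl (∈-∉⇒≢ s∈ y′∉) λ e → ns (trans (adj-twin s∈) e)) here)))))
          where
          x′x = P.sym xx′
          y′y = P.sym yy′
          x′s = P.trans x′x xs
          y′a = P.trans y′y ya

        -- The part of x sees y, and the part of y sees x, in opposite ways: neither part can lie in a few balls,
        -- and two wide parts cannot see each other in opposite ways.
        opposite : (∀ {s} → s ∈ O → P x s → adj G s y ≡ adj G x y) →
          (∀ {a} → a ∈ O → P y a → adj G x a ≡ adj G x′ y′) → ⊥
        opposite allS allA with dense x′ | dense y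
        ... | inj₁ (s , s∈ , x′s , Bx′s) | _ = differ (trans (≡-sym (trans (≡-sym (adj-twin s∈)) (allS s∈ (P.trans xx′ x′s))))
              (near-adj x′≢y′ (s≤s (s≤s z≤n)) far′ x′s Bx′s (∈-∉⇒≢ s∈ y′∉)))
        ... | inj₂ _ | inj₁ (a , a∈ , ya , Bya) = differ (trans (sym G x y) (trans (≡-sym
              (near-adj (x≢y ∘ ≡-sym) (s≤s (s≤s z≤n)) (far ∘ flipBall-sym G) ya Bya (∈-∉⇒≢ a∈ x∉)))
              (trans (sym G a x) (allA a∈ ya))))
        ... | inj₂ (s₁ , s₂ , s₃ , (s₁∈ , x′s₁) , (s₂∈ , x′s₂) , (s₃∈ , x′s₃) , f₁₂ , f₁₃ , f₂₃)
            | inj₂ (a₁ , a₂ , _ , (a₁∈ , ya₁) , (a₂∈ , ya₂) , _ , fa , _) with P? x y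
        -- In a common part, `s₁` and `s₂` agree on `y` with value `adj G x y` and on `x` with value
        -- `adj G x′ y′`; `common-adj` equates the two values.
        ...   | yes xy = differ (≡-sym (trans (≡-sym (see s₁∈ xs₁)) (trans
                (common-adj (P.trans (P.sym x′s₁) x′s₂) f₁₂ (P.sym xy) (∈-∉⇒≢ s₁∈ y∉) (∈-∉⇒≢ s₂∈ y∉) (∈-∉⇒≢ s₁∈ x∉) (∈-∉⇒≢ s₂∈ x∉)
                  (trans (allS s₁∈ xs₁) (≡-sym (allS s₂∈ xs₂))) (trans (see s₁∈ xs₁) (≡-sym (see s₂∈ xs₂))))
                (allS s₁∈ xs₁))))
          where
          xs₁ = P.trans xx′ x′s₁
          xs₂ = P.trans xx′ x′s₂
          see : ∀ {s} → s ∈ O → P x s → adj G s x ≡ adj G x′ y′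
          see {s} s∈ xs = trans (sym G s x) (allA s∈ (P.trans (P.sym xy) xs))
        -- By `row`, each of the three `s` deviates from `f` at `a₁` or at `a₂`; by `column`, no two
        -- deviate at the same one.
        ...   | no ¬xy = pigeonhole₃
            (column s₁∈ xs₁ s₂∈ xs₂ f₁₂ ya₁) (column s₁∈ xs₁ s₃∈ xs₃ f₁₃ ya₁) (column s₂∈ xs₂ s₃∈ xs₃ f₂₃ ya₁)
            (column s₁∈ xs₁ s₂∈ xs₂ f₁₂ ya₂) (column s₁∈ xs₁ s₃∈ xs₃ f₁₃ ya₂) (column s₂∈ xs₂ s₃∈ xs₃ f₂₃ ya₂)
            (row s₁∈ xs₁) (row s₂∈ xs₂) (row s₃∈ xs₃)
          where
          xs₁ = P.trans xx′ x′s₁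
          xs₂ = P.trans xx′ x′s₂
          xs₃ = P.trans xx′ x′s₃
          f : Bool
          f = adj G x y
          apart : ∀ {s a} → P x s → P y a → s ≢ a
          apart xs ya refl = ¬xy (P.trans xs (P.sym ya))
          column : ∀ {s s′ a} → s ∈ O → P x s → s′ ∈ O → P x s′ → ¬ B 2 s s′ → P y a → adj G s a ≢ f → adj G s′ a ≢ f → ⊥
          column s∈ xs s′∈ xs′ f ya ne ne′ = ne (trans
            (common-adj (P.trans (P.sym xs) xs′) f ya (∈-∉⇒≢ s∈ y∉) (∈-∉⇒≢ s′∈ y∉) (apart xs ya) (apart xs′ ya)
              (trans (allS s∈ xs) (≡-sym (allS s′∈ xs′))) (≢-≢⇒≡ ne ne′))
            (allS s∈ xs))
          row : ∀ {s} → s ∈ O → P x s → adj G s a₁ ≢ f ⊎ adj G s a₂ ≢ f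
          row {s} s∈ xs with adj G s a₁ ≟B f | adj G s a₂ ≟B f
          ... | no ne  | _      = inj₁ ne
          ... | yes _  | no ne  = inj₂ ne
          ... | yes e₁ | yes e₂ = contradiction (trans (≡-sym e₁) (trans (sym G s a₁) (trans
                (common-adj (P.trans (P.sym ya₁) ya₂) fa xs (∈-∉⇒≢ a₁∈ x∉) (∈-∉⇒≢ a₂∈ x∉)
                  (apart xs ya₁ ∘ ≡-sym) (apart xs ya₂ ∘ ≡-sym)
                  (trans (sym G a₁ x) (trans (allA a₁∈ ya₁) (trans (≡-sym (allA a₂∈ ya₂)) (sym G x a₂))))
                  (trans (sym G a₁ s) (trans e₁ (trans (≡-sym e₂) (sym G s a₂)))))
                (trans (sym G a₁ x) (allA a₁∈ ya₁))))) differ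

      representative : ∀ v → ∃ λ s → s ∈ O × P v s
      representative v with dense v
      ... | inj₁ (s , s∈ , p , _)     = s , s∈ , p
      ... | inj₂ (s , _ , _ , sp , _) = s , sp

    -- An element of the net is its own only twin, so that case is immediate. Otherwise differing
    -- adjacencies and `path`, used for both pairs, force all net elements in the part of `x` to see
    -- `y` in one way and all those in the part of `y` to see `x` in the other way, which `opposite`
    -- refutes.
    net-homogeneous : ∀ {x y x′ y′} → P x x′ → Twin x x′ → P y y′ → Twin y y′ → x ≢ y → x′ ≢ y′ →
      ¬ B 5 x y → ¬ B 5 x′ y′ → adj G x y ≡ adj G x′ y′
    net-homogeneous {x} {y} {x′} {y′} xx′ tx yy′ ty x≢y x′≢y′ far far′
      with Any.any? (x ≟F_) O | Any.any? (y ≟F_) O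
    ... | yes x∈ | _ with refl ← NS-∈ G tx x∈ = trans (sym G x y) (trans (NS-adj G ty x∈) (sym G y′ x))
    ... | no _ | yes y∈ with refl ← NS-∈ G ty y∈ = NS-adj G tx y∈
    ... | no x∉ | no y∉ with adj G x y ≟B adj G x′ y′
    ...   | yes eq    = eq
    ...   | no differ = ⊥-elim (decide (representative x))
      where
      module T = IsEquivalence (NS-isEquivalence G (_∈ O))
      x′∉ : x′ ∉ O
      x′∉ x′∈ = x∉ (subst (_∈ O) (NS-∈ G (T.sym tx) x′∈) x′∈)
      y′∉ : y′ ∉ O
      y′∉ y′∈ = y∉ (subst (_∈ O) (NS-∈ G (T.sym ty) y′∈) y′∈)
      f f′ : Bool
      f  = adj G x y
      f′ = adj G x′ y′
      path₂ : ∀ {s a} → s ∈ O → P x s → a ∈ O → P y a → adj G s y ≢ f′ → adj G x a ≢ f′ → ⊥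
      path₂ = path x∉ y∉ x′∉ y′∉ xx′ yy′ tx ty x≢y x′≢y′ far far′ differ
      path₁ : ∀ {s a} → s ∈ O → P x s → a ∈ O → P y a → adj G s y ≢ f → adj G x a ≢ f → ⊥
      path₁ {s} {a} s∈ xs a∈ ya ns na =
        path x′∉ y′∉ x∉ y∉ (P.sym xx′) (P.sym yy′) (T.sym tx) (T.sym ty) x′≢y′ x≢y far′ far (differ ∘ ≡-sym)
          s∈ (P.trans (P.sym xx′) xs) a∈ (P.trans (P.sym yy′) ya)
          (λ e → ns (trans (sym G s y) (trans (NS-adj G ty s∈) (trans (sym G y′ s) e))))
          (λ e → na (trans (NS-adj G tx a∈) e))
      force : ∀ {b c : Bool} → (b ≢ c → ⊥) → b ≡ c
      force {b} {c} h with b ≟B c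
      ... | yes e = e
      ... | no ne = ⊥-elim (h ne)
      decide : ∃ (λ s → s ∈ O × P x s) → ⊥
      -- One net element fixes which of the two ways occurs; in the second case `opposite` is
      -- applied with the roles of `x` and `y` exchanged.
      decide (s , s∈ , xs) with adj G s y ≟B f
      ... | yes e = opposite x∉ y∉ x′∉ y′∉ xx′ yy′ tx ty x≢y x′≢y′ far far′ differ allS allA
        where
        allA : ∀ {a} → a ∈ O → P y a → adj G x a ≡ f′
        allA a∈ ya = force (path₂ s∈ xs a∈ ya λ e′ → differ (trans (≡-sym e) e′))
        allS : ∀ {s} → s ∈ O → P x s → adj G s y ≡ f
        allS s∈ xs with representative y
        ... | a , a∈ , ya = force λ ne → path₁ s∈ xs a∈ ya ne λ e′ → differ (trans (≡-sym e′) (allA a∈ ya))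
      ... | no ne = opposite y∉ x∉ y′∉ x′∉ yy′ xx′ ty tx (x≢y ∘ ≡-sym) (x′≢y′ ∘ ≡-sym)
          (far ∘ flipBall-sym G) (far′ ∘ flipBall-sym G)
          (λ e → differ (trans (sym G x y) (trans e (sym G y′ x′))))
          (λ {a} a∈ ya → trans (sym G a x) (trans (allA a∈ ya) (sym G x y)))
          (λ {s} s∈ xs → trans (sym G y s) (trans (allS s∈ xs) (sym G x′ y′)))
        where
        allA : ∀ {a} → a ∈ O → P y a → adj G x a ≡ f
        allA a∈ ya = force (path₁ s∈ xs a∈ ya ne)
        allS : ∀ {s} → s ∈ O → P x s → adj G s y ≡ f′
        allS s∈ xs with representative y
        ... | a , a∈ , ya = force λ ne′ → path₂ s∈ xs a∈ ya ne′ λ e′ → differ (trans (≡-sym (allA a∈ ya)) e′)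

DecMW : ℕ → ℕ → ∀ {n} → Graph n → Set₁
DecMW r k G = Σ (MergeSeq G) λ S → DecChain (chain S) × (∀ t → t < m (chain S) → ∀ v →
  PartsLE (P (chain S) t) (Reach (BEdge (R S (suc t))) r v) k)

DecPMW : ℕ → ℕ → ∀ {n} → Graph n → Set₁
DecPMW r k {n} G = Σ (Chain n) λ c → DecChain c ×
  (∀ t → t < m c → ∀ v → PartsLE (P c t) (FlipBall (P c (suc t)) G r v) k)

classBound-mono : ∀ d {k k′} → k ≤ k′ → classBound d k ≤ classBound d k′
classBound-mono d k≤k′ = +-mono-≤ (*-monoˡ-≤ 3 k≤k′) (*-mono-≤ k≤k′ (^-monoˡ-≤ d (s≤s (*-monoʳ-≤ 2 (*-monoˡ-≤ 3 k≤k′)))))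

-- In a flip separating `v` from `s` no vertex of the ball is a neighbour of `s`. Its adjacency to
-- `s` in `G` is therefore the flip bit, which depends only on its part.
far-adj : ∀ {n} (G : Graph n) {P : Rel (Fin n) 0ℓ} (P? : Dec₂ P) (P-equiv : IsEquivalence P) {ρ v s x x′} →
  ¬ FlipBall P G (suc ρ) v s → FlipBall P G ρ v x → FlipBall P G ρ v x′ → P x x′ → adj G x s ≡ adj G x′ s
far-adj G {P} P? P-equiv {ρ} {v} {s} {x} {x′} ¬B Bx Bx′ xx′ with flipBall-search G P? (suc ρ) v s
... | inj₁ b = contradiction b ¬B
... | inj₂ (G′ , fl@(F , _ , Finv , F-adj) , ¬reach) = trans (adj≡F Bx) (trans (Finv x x′ s s xx′ (IsEquivalence.refl P-equiv)) (≡-sym (adj≡F Bx′)))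
  where
  adj≡F : ∀ {z} → FlipBall P G ρ v z → adj G z s ≡ F z s
  adj≡F {z} Bz with adj G z s ≟B F z s
  ... | yes e = e
  ... | no ne = contradiction (Reach-≤ (≤-reflexive (+-comm ρ 1)) (Reach-trans (Bz G′ fl)
          (step (trans (F-adj z s λ { refl → ¬B (flipBall-≤ G (n≤1+n ρ) Bz) }) (xor-≢ ne)) here))) ¬reach

module _ {n : ℕ} {P Close : Rel (Fin n) 0ℓ} {P? : Dec₂ P} (P-equiv : IsEquivalence P) {O : List (Fin n)}
  (net : Net P? Close O) where

  open Net net

  membersOf : List (Fin n) → List (Fin n)
  membersOf = concatMap partMembers

  membersOf-length : ∀ L {k} → length L ≤ k → length (membersOf L) ≤ k * 3
  membersOf-length L L≤k = ≤-trans (length-concatMap-≤ partMembers L few) (*-monoˡ-≤ 3 L≤k)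

  membersOf-⊆ : ∀ L {s} → s ∈ membersOf L → s ∈ O
  membersOf-⊆ L s∈ with find (∈-concatMap⁻ partMembers {xs = L} s∈)
  ... | y , _ , s∈y = proj₁ (∈-filter⁻ (P? y) s∈y)

  ∈-membersOf : ∀ L {s} → s ∈ O → Any (P s) L → s ∈ membersOf L
  ∈-membersOf L s∈O cov with find cov
  ... | y , y∈L , sy = ∈-concatMap partMembers y∈L (∈-filter⁺ (P? y) s∈O (IsEquivalence.sym P-equiv sy))

module _ {n : ℕ} (G : Graph n) {d : ℕ} (noShatter : NoShatter G d) {k r : ℕ} (1≤k : 1 ≤ k) where

  -- Each pair in `R′` spans distance at most 5 in the partition metric, and `far-adj` costs one
  -- further unit of radius.
  partition⇒merge : DecPMW (suc (r * 5)) k G → DecMW r (classBound d k) G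
  partition⇒merge (c , P? , width) = seq , Q? , seq-width
    where
    M : ℕ
    M = m c

    B : ℕ → ℕ → Rel (Fin n) 0ℓ
    B t = FlipBall (P c t) G

    B? : ∀ t ρ → Dec₂ (B t ρ)
    B? t = flipBall? G (P? t)

    B-mono : ∀ ρ t → t < M → ∀ {x y} → B t ρ x y → B (suc t) ρ x y
    B-mono ρ t t<M = flipBall-coarsen G λ {x} {y} → coarse c t t<M x y

    open NetSeq (netSeq c P? (λ t → B? t 2) (λ t _ _ → here) (λ t _ → flipBall-sym G) (B-mono 2))

    -- NS of the last net need not be trivial, hence the additional step M + 1.
    Q : ℕ → Rel (Fin n) 0ℓ
    Q t x y = t ≤ M → P c t x y × NS G (_∈ O t) x y

    ∈O? : ∀ t x → Dec (x ∈ O t)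
    ∈O? t x = Any.any? (x ≟F_) (O t)

    Q? : ∀ t → Dec₂ (Q t)
    Q? t x y = (t ≤? M) →-dec (P? t x y ×-dec NS? G (∈O? t) x y)

    Q-equiv : ∀ t → t ≤ suc M → IsEquivalence (Q t)
    Q-equiv t _ = record
      { refl  = λ t≤M → IsEquivalence.refl (equiv c t t≤M) , inj₁ refl
      ; sym   = λ q t≤M → IsEquivalence.sym (equiv c t t≤M) (proj₁ (q t≤M)) , N.sym (proj₂ (q t≤M))
      ; trans = λ q q′ t≤M → IsEquivalence.trans (equiv c t t≤M) (proj₁ (q t≤M)) (proj₁ (q′ t≤M)) ,
                             N.trans (proj₂ (q t≤M)) (proj₂ (q′ t≤M))
      }
      where module N = IsEquivalence (NS-isEquivalence G (_∈ O t))

    O-⊆ : ∀ t → t < M → ∀ {w} → w ∈ O (suc t) → w ∈ O t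
    O-⊆ t t<M {w} w∈ with nested t t<M
    ... | X , eq = subst (w ∈_) (≡-sym eq) (∈-++⁺ˡ w∈)

    Q-chain : Chain n
    Q-chain = record
      { m      = suc M
      ; P      = Q
      ; equiv  = Q-equiv
      ; single = λ x y q → single c x y (proj₁ (q z≤n))
      ; whole  = λ x y M<M → contradiction M<M (<-irrefl refl)
      ; coarse = λ t _ x y q t<M → coarse c t t<M x y (proj₁ (q (<⇒≤ t<M))) ,
                   NS-antitone G (O-⊆ t t<M) (proj₂ (q (<⇒≤ t<M)))
      }

    -- At the additional index `suc M` every pair is short, so homogeneity is vacuous there.
    Short : ℕ → Rel (Fin n) 0ℓ
    Short t x y = t ≤ M → B t 5 x y

    Short? : ∀ t → Dec₂ (Short t)
    Short? t x y = (t ≤? M) →-dec B? t 5 x y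

    R′ : ℕ → Fin n → Fin n → Bool
    R′ t x y = ⌊ Short? t x y ⌋

    long : ∀ {t x y} → R′ t x y ≡ false → t ≤ M × ¬ B t 5 x y
    long {t} {x} {y} eq = split (t ≤? M) (⌊⌋≡false⇒ (Short? t x y) eq)
      where
      split : Dec (t ≤ M) → ¬ Short t x y → t ≤ M × ¬ B t 5 x y
      split (yes t≤M) ¬short = t≤M , λ b → ¬short λ _ → b
      split (no t≰M)  ¬short = contradiction (λ t≤M → contradiction t≤M t≰M) ¬short

    seq : MergeSeq G
    seq = record
      { chain = Q-chain
      ; R     = R′
      ; Rsym  = λ t _ x y → does-⇔ (Short? t x y) (Short? t y x) (λ s → flipBall-sym G ∘ s) (λ s → flipBall-sym G ∘ s)
      ; Rmono = λ t _ x y eq → ⇒⌊⌋≡true (Short? (suc t) x y)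
                  λ t<M → B-mono 5 t t<M (⌊⌋≡true⇒ (Short? t x y) eq (<⇒≤ t<M))
      ; homog = λ t _ x y x′ y′ qx qy x≢y x′≢y′ Rxy Rx′y′ → let t≤M = proj₁ (long {t} {x} {y} Rxy) in
          net-homogeneous G (P? t) (equiv c t t≤M) (net t t≤M)
            (proj₁ (qx t≤M)) (proj₂ (qx t≤M)) (proj₁ (qy t≤M)) (proj₂ (qy t≤M)) x≢y x′≢y′
            (proj₂ (long {t} {x} {y} Rxy)) (proj₂ (long {t} {x′} {y′} Rx′y′))
      }

    Reach⇒B : ∀ {t ρ v u} → t ≤ M → Reach (BEdge (R′ t)) ρ v u → B t (ρ * 5) v u
    Reach⇒B t≤M here = λ _ _ → here
    Reach⇒B {t} {v = v} t≤M (step {w = w} e p) = flipBall-trans G (⌊⌋≡true⇒ (Short? t v w) e t≤M) (Reach⇒B t≤M p)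

    seq-width : ∀ t → t < suc M → ∀ v → PartsLE (Q t) (Reach (BEdge (R′ (suc t))) r v) (classBound d k)
    seq-width t t<1+M v = split (suc t ≤? M)
      where
      split : Dec (t < M) → PartsLE (Q t) (Reach (BEdge (R′ (suc t))) r v) (classBound d k)
      split (yes t<M) = PartsLE-coarsen (λ q _ → q) (PartsLE-⊆ (Reach⇒B t<M)
          (classes-≤ G noShatter (P? t) (equiv c t t≤M) (∈O? t) (B? (suc t) (r * 5) v) T
            (All-tabulate (membersOf-⊆ P-equiv (net t t≤M) L)) (membersOf-length P-equiv (net t t≤M) L L≤k)
            (λ Bx x∈O → ∈-membersOf P-equiv (net t t≤M) L x∈O (L-cov _ (flipBall-≤ G (n≤1+n _) Bx)))
            (λ Bx Bx′ xx′ s∈O s∉T → far-adj G (P? (suc t)) (equiv c (suc t) t<M)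
              (λ Bs → s∉T (∈-membersOf P-equiv (net t t≤M) L s∈O (L-cov _ Bs))) Bx Bx′ (coarse c t t<M _ _ xx′))
            (L , L≤k , λ x Bx → L-cov x (flipBall-≤ G (n≤1+n _) Bx))))
        where
        t≤M : t ≤ M
        t≤M = <⇒≤ t<M
        P-equiv : IsEquivalence (P c t)
        P-equiv = equiv c t t≤M
        L : List (Fin n)
        L = proj₁ (width t t<M v)
        L≤k : length L ≤ k
        L≤k = proj₁ (proj₂ (width t t<M v))
        L-cov : ∀ x → B (suc t) (suc (r * 5)) v x → Any (P c t x) L
        L-cov = proj₂ (proj₂ (width t t<M v))
        T : List (Fin n)
        T = membersOf P-equiv (net t t≤M) L
      -- The additional step: the partition at `M` has a single part, so all of its classes are
      -- counted by `classBound d 1`.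
      split (no t≮M) with refl ← ≤-antisym (≤-pred t<1+M) (≮⇒≥ t≮M) =
          PartsLE-coarsen (λ q _ → q) (PartsLE-⊆ {X = λ _ → ⊤} _ (PartsLE-≤ (classBound-mono d 1≤k)
          (classes-≤ G noShatter (P? M) P-equiv (∈O? M) (λ _ → yes tt) (membersOf P-equiv net′ (v ∷ []))
            (All-tabulate (membersOf-⊆ P-equiv net′ (v ∷ []))) (membersOf-length P-equiv net′ (v ∷ []) ≤-refl)
            (λ _ x∈O → all-members x∈O) (λ _ _ _ s∈O s∉T → contradiction (all-members s∈O) s∉T)
            (v ∷ [] , ≤-refl , λ x _ → here (whole c x v)))))
        where
        P-equiv : IsEquivalence (P c M)
        P-equiv = equiv c M ≤-refl
        net′ = net M ≤-refl
        all-members : ∀ {x} → x ∈ O M → x ∈ membersOf P-equiv net′ (v ∷ [])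
        all-members x∈O = ∈-membersOf P-equiv net′ (v ∷ []) x∈O (here (whole c _ v))

-- From merge sequences to definable ones

module _ {n : ℕ} (G : Graph n) {Q : Rel (Fin n) 0ℓ} (Q? : Dec₂ Q) (Q-equiv : IsEquivalence Q)
  {R : Fin n → Fin n → Bool} (R-sym : ∀ x y → R x y ≡ R y x) (homogeneous : Homogeneous G Q R)
  {O : List (Fin n)} (net : Net Q? (Reach (BEdge R) 2) O)
  {S : Fin n → Set} (S? : ∀ x → Dec (S x)) (O⊆S : ∀ {w} → w ∈ O → S w) where

  private
    module Q = IsEquivalence Q-equiv
    module N = IsEquivalence (NS-isEquivalence G S)

    Ball : ℕ → Rel (Fin n) 0ℓ
    Ball = Reach (BEdge R)

    Ball? : ∀ ρ → Dec₂ (Ball ρ)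
    Ball? = Reach? λ x y → R x y ≟B true

    Ball-sym : ∀ {ρ x y} → Ball ρ x y → Ball ρ y x
    Ball-sym = Reach-sym λ {x} {y} e → trans (R-sym y x) e

    Far : Rel (Fin n) 0ℓ
    Far x y = ¬ Ball 3 x y

    Far? : Dec₂ Far
    Far? x y = ¬? (Ball? 3 x y)

    Far-sym : ∀ {x y} → Far x y → Far y x
    Far-sym far = far ∘ Ball-sym

    ¬Ball⇒≢ : ∀ {ρ x y} → ¬ Ball ρ x y → x ≢ y
    ¬Ball⇒≢ ¬b refl = ¬b here

    ¬Ball⇒R : ∀ {ρ x y} → ¬ Ball (suc ρ) x y → R x y ≡ false
    ¬Ball⇒R {x = x} {y} ¬b with R x y in eq
    ... | true  = contradiction (step eq here) ¬b
    ... | false = refl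

    far-adj≡ : ∀ {x s y} → Q x s → ¬ Ball 1 s y → Far x y → adj G s y ≡ adj G x y
    far-adj≡ {x} {s} {y} xs ¬b far =
      homogeneous s y x y (Q.sym xs) Q.refl (¬Ball⇒≢ ¬b) (¬Ball⇒≢ far) (¬Ball⇒R ¬b) (¬Ball⇒R far)

    -- A net element of the part of `x` works by homogeneity once it is at distance more than 1 from
    -- `y` and `y′`. If it is within 2 of `x`, this follows from `Far`; among three elements
    -- pairwise more than 2 apart, `y` and `y′` exclude at most one each.
    representative : ∀ {x y y′} → Far x y → Far x y′ →
      ∃ λ s → s ∈ O × adj G s y ≡ adj G x y × adj G s y′ ≡ adj G x y′
    representative {x} {y} {y′} far far′ with Net.dense net x
    ... | inj₁ (s , s∈ , xs , near) = s , s∈ ,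
      far-adj≡ xs (λ b → far (Reach-trans near b)) far , far-adj≡ xs (λ b → far′ (Reach-trans near b)) far′
    ... | inj₂ (s₁ , s₂ , s₃ , (s₁∈ , xs₁) , (s₂∈ , xs₂) , (s₃∈ , xs₃) , f₁₂ , f₁₃ , f₂₃)
      with try s₁∈ xs₁ | try s₂∈ xs₂ | try s₃∈ xs₃
      where
      try : ∀ {s} → s ∈ O → Q x s →
        (∃ λ s → s ∈ O × adj G s y ≡ adj G x y × adj G s y′ ≡ adj G x y′) ⊎ (Ball 1 s y ⊎ Ball 1 s y′)
      try {s} s∈ xs with Ball? 1 s y | Ball? 1 s y′
      ... | yes b | _      = inj₂ (inj₁ b)
      ... | no _  | yes b  = inj₂ (inj₂ b)
      ... | no ¬b | no ¬b′ = inj₁ (s , s∈ , far-adj≡ xs ¬b far , far-adj≡ xs ¬b′ far′)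
    ...   | inj₁ good | _ | _ = good
    ...   | inj₂ _ | inj₁ good | _ = good
    ...   | inj₂ _ | inj₂ _ | inj₁ good = good
    ...   | inj₂ b₁ | inj₂ b₂ | inj₂ b₃ = ⊥-elim (pigeonhole₃
            (λ p q → f₁₂ (meet p q)) (λ p q → f₁₃ (meet p q)) (λ p q → f₂₃ (meet p q))
            (λ p q → f₁₂ (meet p q)) (λ p q → f₁₃ (meet p q)) (λ p q → f₂₃ (meet p q)) b₁ b₂ b₃)
      where
      meet : ∀ {s s′ z} → Ball 1 s z → Ball 1 s′ z → Ball 2 s s′
      meet b b′ = Reach-trans b (Ball-sym b′)

    row : ∀ {x y y′} → NS G S y y′ → Far x y → Far x y′ → adj G x y ≡ adj G x y′
    row {x} {y} {y′} yy′ far far′ with representative far far′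
    ... | s , s∈ , e , e′ = trans (≡-sym e) (trans (trans (sym G s y) (trans (NS-adj G yy′ (O⊆S s∈)) (sym G y′ s))) e′)

    column : ∀ {x x′ y} → NS G S x x′ → Far x y → Far x′ y → adj G x y ≡ adj G x′ y
    column {x} {x′} {y} xx′ far far′ = trans (sym G x y) (trans (row xx′ (Far-sym far) (Far-sym far′)) (sym G y x′))

    module Exceptional {x y x₁ y₁ : Fin n} (xx₁ : NS G S x x₁) (yy₁ : NS G S y y₁)
      (far : Far x y) (far₁ : Far x₁ y₁) (differ : adj G x y ≢ adj G x₁ y₁) where

      -- Otherwise `row` and `column` carry the adjacency from `x y` over `x y₁` to `x₁ y₁`.
      close : Ball 3 x y₁
      close with Ball? 3 x y₁
      ... | yes b  = b
      ... | no far′ = contradiction (trans (row yy₁ far far′) (column xx₁ far′ far₁)) differ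

      close₁ : Ball 3 x₁ y
      close₁ with Ball? 3 x₁ y
      ... | yes b  = b
      ... | no far′ = contradiction (trans (column xx₁ far far′) (row yy₁ far′ far₁)) differ

      -- If `w` were far from both `x` and `x₁`, the adjacency would be carried over `x w` and
      -- `x₁ w`. Near `x₁` means near `y`, by `close₁`.
      located : ∀ {w} → NS G S y w → Ball 3 x w ⊎ Ball 6 y w
      located {w} yw with Ball? 3 x w | Ball? 3 x₁ w
      ... | yes b | _     = inj₁ b
      ... | no _  | yes b = inj₂ (Reach-trans (Ball-sym close₁) b)
      ... | no f  | no f₁ = contradiction
        (trans (row yw far f) (trans (column xx₁ f f₁) (row (N.trans (N.sym yw) yy₁) f₁ far₁))) differ

    G′ : Graph n
    G′ = farFlip G (NS-isEquivalence G S) (NS? G S?) Far? Far-sym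

    Exc : Rel (Fin n) 0ℓ
    Exc x y = Far x y × GEdge G′ x y

    Exc? : Dec₂ Exc
    Exc? x y = Far? x y ×-dec (adj G′ x y ≟B true)

    exc-close : ∀ {x y} → Exc x y → ∃ λ y₁ → NS G S y y₁ × Ball 3 x y₁
    exc-close (far , e) with farFlip-edge G (NS-isEquivalence G S) (NS? G S?) Far? Far-sym far e
    ... | a , x₁ , y₁ , xx₁ , yy₁ , far₁ , a₁ =
      y₁ , yy₁ , Exceptional.close xx₁ yy₁ far far₁ λ eq → true≢false (trans (≡-sym a₁) (trans (≡-sym eq) a))

    exc-located : ∀ {x y w} → Exc x y → NS G S y w → Ball 3 x w ⊎ Ball 6 y w
    exc-located (far , e) with farFlip-edge G (NS-isEquivalence G S) (NS? G S?) Far? Far-sym far e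
    ... | a , x₁ , y₁ , xx₁ , yy₁ , far₁ , a₁ =
      Exceptional.located xx₁ yy₁ far far₁ λ eq → true≢false (trans (≡-sym a₁) (trans (≡-sym eq) a))

  module _ {ρ⁺ k : ℕ} (classes : ∀ z → PartsLE (NS G S) (Ball ρ⁺ z) k) where

    private
      L : Fin n → List (Fin n)
      L z = proj₁ (classes z)

      L-cov : ∀ z x → Ball ρ⁺ z x → Any (NS G S x) (L z)
      L-cov z = proj₂ (proj₂ (classes z))

      -- One exceptional edge per pair of classes is recorded. By `exc-located` it confines the
      -- whole target class to a ball around `z` and a ball around the recorded endpoint.
      ExcFrom : ℕ → Fin n → Fin n → Fin n → Set
      ExcFrom ρ z p q = ∃ λ x → ∃ λ y → NS G S p x × NS G S q y × Ball ρ z x × Exc x y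

      excFrom? : ∀ ρ z p q → Dec (ExcFrom ρ z p q)
      excFrom? ρ z p q = any? λ x → any? λ y → NS? G S? p x ×-dec (NS? G S? q y ×-dec (Ball? ρ z x ×-dec Exc? x y))

      landing : ∀ {ρ z p q} → Dec (ExcFrom ρ z p q) → Fin n
      landing         (yes (_ , y , _)) = y
      -- A default value; such an entry is never the one used in `step-covered`.
      landing {z = z} (no _)            = z

      landings : ℕ → Fin n → Fin n → List (Fin n)
      landings ρ z p = map (λ q → landing (excFrom? ρ z p q)) (L z)

      centres : ℕ → Fin n → List (Fin n)
      centres ρ z = z ∷ concatMap (landings ρ z) (L z)

      centres-length : ∀ ρ z → length (centres ρ z) ≤ suc (k * k)
      centres-length ρ z = s≤s (≤-trans (length-concatMap-≤ (landings ρ z) (L z)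
        λ p → ≤-trans (≤-reflexive (length-map _ (L z))) (proj₁ (proj₂ (classes z))))
        (*-monoˡ-≤ k (proj₁ (proj₂ (classes z)))))

      -- A short edge stays near `z`. An exceptional one ends in a class meeting the ball of radius
      -- `ρ + 3`, by `exc-close`, hence in a listed class, and the edge recorded for this pair of
      -- classes locates `w`.
      step-covered : ∀ {ρ z x w} → ρ + 3 ≤ ρ⁺ → Ball ρ z x → GEdge G′ x w → Any (λ c → Ball (ρ + 6) c w) (centres ρ z)
      step-covered {ρ} {z} {x} {w} ρ+3≤ zx e with Ball? 3 x w
      ... | yes xw = here (Reach-≤ (+-monoʳ-≤ ρ (s≤s (s≤s (s≤s z≤n)))) (Reach-trans zx xw))
      ... | no far with exc-close {x} {w} (far , e)
      ...   | y₁ , wy₁ , xy₁ with find (L-cov z x (Reach-≤ (m+n≤o⇒m≤o ρ ρ+3≤) zx)) | find (L-cov z y₁ (Reach-≤ ρ+3≤ (Reach-trans zx xy₁)))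
      ...     | p , p∈L , xp | q , q∈L , y₁q = land (excFrom? ρ z p q)
                (∈-concatMap (landings ρ z) p∈L (∈-map⁺ (λ q → landing (excFrom? ρ z p q)) q∈L))
        where
        land : (exc? : Dec (ExcFrom ρ z p q)) → landing exc? ∈ concatMap (landings ρ z) (L z) →
          Any (λ c → Ball (ρ + 6) c w) (centres ρ z)
        land (no ¬exc) _ = contradiction
          (x , w , N.sym xp , N.sym (N.trans wy₁ y₁q) , zx , far , e) ¬exc
        land (yes (x′ , y′ , px′ , qy′ , zx′ , exc)) mem
          with exc-located exc (N.trans (N.sym qy′) (N.sym (N.trans wy₁ y₁q)))
        ... | inj₁ b = here (Reach-≤ (+-monoʳ-≤ ρ (s≤s (s≤s (s≤s z≤n)))) (Reach-trans zx′ b))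
        ... | inj₂ b = there (lose mem (Reach-≤ (m≤n+m 6 ρ) b))

      BallCover : ℕ → ℕ → Fin n → Set
      BallCover i ρ z = Σ (List (Fin n)) λ Z → length Z ≤ suc (k * k) ^ i ×
        (∀ {x u} → Ball ρ z x → Reach (GEdge G′) i x u → Any (λ c → Ball ρ⁺ c u) Z)

      -- Every step in the flip replaces a ball by at most `suc (k * k)` balls with radius larger by
      -- 6; classes are counted only up to radius `ρ⁺`.
      ballCover : ∀ i ρ z → ρ + i * 6 ≤ ρ⁺ → BallCover i ρ z
      ballCover zero    ρ z ρ≤ = z ∷ [] , ≤-refl , λ { zx here → here (Reach-≤ (m+n≤o⇒m≤o ρ ρ≤) zx) }
      ballCover (suc i) ρ z ρ≤ = concatMap next (centres ρ z) , bound , cover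
        where
        ih : ∀ c → BallCover i (ρ + 6) c
        ih c = ballCover i (ρ + 6) c (≤-trans (≤-reflexive (+-assoc ρ 6 (i * 6))) ρ≤)
        next : Fin n → List (Fin n)
        next c = proj₁ (ih c)
        ρ+3≤ : ρ + 3 ≤ ρ⁺
        ρ+3≤ = ≤-trans (+-monoʳ-≤ ρ (s≤s (s≤s (s≤s z≤n)))) ρ≤
        bound : length (concatMap next (centres ρ z)) ≤ suc (k * k) ^ suc i
        bound = ≤-trans (length-concatMap-≤ next (centres ρ z) λ c → proj₁ (proj₂ (ih c)))
                        (*-monoˡ-≤ (suc (k * k) ^ i) (centres-length ρ z))
        through : ∀ {w u} → Any (λ c → Ball (ρ + 6) c w) (centres ρ z) → Reach (GEdge G′) i w u →
          Any (λ c → Ball ρ⁺ c u) (concatMap next (centres ρ z))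
        through cov p with find cov
        ... | c , c∈ , cw with find (proj₂ (proj₂ (ih c)) cw p)
        ...   | c′ , c′∈ , b = lose (∈-concatMap next c∈ c′∈) b
        cover : ∀ {x u} → Ball ρ z x → Reach (GEdge G′) (suc i) x u → Any (λ c → Ball ρ⁺ c u) (concatMap next (centres ρ z))
        cover zx here       = through (here (Reach-≤ (m≤m+n ρ 6) zx)) here
        cover zx (step e p) = through (step-covered ρ+3≤ zx e) p

    flipBall-classes : ∀ {r} → r * 6 ≤ ρ⁺ → ∀ v → PartsLE (NS G S) (FlipBall (NS G S) G r v) (suc (k * k) ^ r * k)
    flipBall-classes {r} r≤ v = concatMap L Z ,
        ≤-trans (length-concatMap-≤ L Z λ z → proj₁ (proj₂ (classes z))) (*-monoˡ-≤ k Z≤) , cover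
      where
      Z : List (Fin n)
      Z = proj₁ (ballCover r 0 v r≤)
      Z≤ : length Z ≤ suc (k * k) ^ r
      Z≤ = proj₁ (proj₂ (ballCover r 0 v r≤))
      cover : ∀ u → FlipBall (NS G S) G r v u → Any (NS G S u) (concatMap L Z)
      cover u b with find (proj₂ (proj₂ (ballCover r 0 v r≤)) here
                      (b G′ (farFlip-isFlip G (NS-isEquivalence G S) (NS? G S?) Far? Far-sym)))
      ... | z , z∈ , zu with find (L-cov z u zu)
      ...   | y , y∈ , uy = lose (∈-concatMap L z∈ y∈) uy

-- Orders from lists

index<⇒∈-take : {A : Set} {w : A} {xs : List A} (w∈ : w ∈ xs) {p : ℕ} → toℕ (Any.index w∈) < p → w ∈ take p xs
index<⇒∈-take (here eq)  {suc p} _         = here eq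
index<⇒∈-take (there w∈) {suc p} (s≤s i<p) = there (index<⇒∈-take w∈ i<p)

∈-take⇒index< : {A : Set} {w : A} (xs : List A) (p : ℕ) → w ∈ take p xs → Σ (w ∈ xs) λ w∈ → toℕ (Any.index w∈) < p
∈-take⇒index< (x ∷ xs) (suc p) (here eq)  = here eq , s≤s z≤n
∈-take⇒index< (x ∷ xs) (suc p) (there w∈) with ∈-take⇒index< xs p w∈
... | w∈′ , i<p = there w∈′ , s≤s i<p

take-⊆-prefix : {A : Set} {w : A} (xs : List A) {ys : List A} (p : ℕ) → p ≤ length xs → w ∈ take p (xs ++ ys) → w ∈ xs
take-⊆-prefix (x ∷ xs) (suc p) _         (here eq)  = here eq
take-⊆-prefix (x ∷ xs) (suc p) (s≤s p≤) (there w∈) = there (take-⊆-prefix xs p p≤ w∈)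

prefix-⊆-take : {A : Set} {w : A} (xs : List A) {ys : List A} (p : ℕ) → length xs ≤ p → w ∈ xs → w ∈ take p (xs ++ ys)
prefix-⊆-take (x ∷ xs) (suc p) _        (here eq)  = here eq
prefix-⊆-take (x ∷ xs) (suc p) (s≤s ≤p) (there w∈) = there (prefix-⊆-take xs p ≤p w∈)

unique-index : {A : Set} {xs : List A} → Unique xs → ∀ {v w} (v∈ : v ∈ xs) (w∈ : w ∈ xs) → v ≡ w → Any.index v∈ ≡ Any.index w∈
unique-index (_ ∷ u)   (here refl) (here refl) _    = refl
unique-index (x∉ ∷ _) (here refl) (there w∈)  refl = contradiction refl (All-lookup x∉ w∈)
unique-index (x∉ ∷ _) (there v∈)  (here refl) refl = contradiction refl (All-lookup x∉ v∈)
unique-index (_ ∷ u)   (there v∈)  (there w∈)  eq   = cong suc (unique-index u v∈ w∈ eq)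

index-injective : {A : Set} {xs : List A} {v w : A} (v∈ : v ∈ xs) (w∈ : w ∈ xs) → Any.index v∈ ≡ Any.index w∈ → v ≡ w
index-injective (here refl) (here refl) _  = refl
index-injective (there v∈)  (there w∈)  eq = index-injective v∈ w∈ (suc-injective eq)

index-lookup : ∀ {A : Set} (xs : List A) i → Any.index (∈-lookup {xs = xs} i) ≡ i
index-lookup (x ∷ xs) zero    = refl
index-lookup (x ∷ xs) (suc i) = cong suc (index-lookup xs i)

unique-length-≤ : {A : Set} {xs ys : List A} → Unique xs → (∀ {w} → w ∈ xs → w ∈ ys) → length xs ≤ length ys
unique-length-≤ {xs = xs} {ys} u xs⊆ys = injective⇒≤ {f = f} f-injective
  where
  f : Fin (length xs) → Fin (length ys)
  f i = Any.index (xs⊆ys (∈-lookup i))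
  f-injective : Injective _≡_ _≡_ f
  f-injective {i} {j} eq = trans (≡-sym (index-lookup xs i)) (trans
    (unique-index u (∈-lookup i) (∈-lookup j) (index-injective _ _ eq)) (index-lookup xs j))

-- Positions form a vector rather than a function, so that all orders can be searched.
Positions : ∀ {n} → List (Fin n) → Vec (Fin n) n → Set
Positions {n} O ps = Injective _≡_ _≡_ (lookup ps) ×
  (∀ {w p} → toℕ (lookup ps w) < p → w ∈ take p O) × (∀ {w p} → w ∈ take p O → toℕ (lookup ps w) < p)

positions : ∀ {n} {O : List (Fin n)} → Unique O → (∀ v → v ∈ O) → ∃ (Positions O)
positions {n} {O} u all = tabulate pos , injective , to , from
  where
  O≤n : length O ≤ n
  O≤n = ≤-trans (unique-length-≤ u λ {w} _ → ∈-allFin w) (≤-reflexive (length-tabulate (λ i → i)))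
  pos : Fin n → Fin n
  pos w = inject≤ (Any.index (all w)) O≤n
  toℕ-pos : ∀ w → toℕ (lookup (tabulate pos) w) ≡ toℕ (Any.index (all w))
  toℕ-pos w = trans (cong toℕ (lookup∘tabulate pos w)) (toℕ-inject≤ _ O≤n)
  injective : Injective _≡_ _≡_ (lookup (tabulate pos))
  injective {v} {w} eq = index-injective (all v) (all w) (toℕ-injective
    (trans (≡-sym (toℕ-pos v)) (trans (cong toℕ eq) (toℕ-pos w))))
  to : ∀ {w p} → toℕ (lookup (tabulate pos) w) < p → w ∈ take p O
  to {w} <p = index<⇒∈-take (all w) (≤-trans (s≤s (≤-reflexive (≡-sym (toℕ-pos w)))) <p)
  from : ∀ {w p} → w ∈ take p O → toℕ (lookup (tabulate pos) w) < p
  from {w} {p} w∈ with ∈-take⇒index< O p w∈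
  ... | w∈O , i<p = ≤-trans (s≤s (≤-reflexive (trans (toℕ-pos w) (cong toℕ (unique-index u (all w) w∈O refl))))) i<p

DefinableOrder : ℕ → ℕ → ∀ {n} → Graph n → Vec (Fin n) n → Set
DefinableOrder r k {n} G ps = Injective _≡_ _≡_ (lookup ps) ×
  (∀ i → 1 ≤ i → i ≤ n → ∀ v → PartsLE (NS G (S i)) (FlipBall (NS G (S i)) G r v) k)
  where
  S : ℕ → Fin n → Set
  S i w = toℕ (lookup ps w) < n ∸ i

-- The bound of `flipBall-classes` with `classBound d k` classes in each ball.
definableBound : ℕ → ℕ → ℕ → ℕ
definableBound r d k = suc (classBound d k * classBound d k) ^ r * classBound d k

module _ {n : ℕ} (G : Graph n) {d : ℕ} (noShatter : NoShatter G d) {k r : ℕ} (1≤k : 1 ≤ k) where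

  -- The covering balls need radius `r * 6`; one more unit ensures that elements of `S` outside `T`
  -- form no pair of `R` with a vertex of the ball.
  merge⇒definable : DecMW (suc (r * 6)) k G → ∃ (DefinableOrder r (definableBound r d k) G)
  merge⇒definable (seq , P? , width) = ps , proj₁ ps-pos , order-width
    where
    c : Chain n
    c = chain seq

    M : ℕ
    M = m c

    Ball : ℕ → ℕ → Rel (Fin n) 0ℓ
    Ball t = Reach (BEdge (R seq t))

    Ball? : ∀ t ρ → Dec₂ (Ball t ρ)
    Ball? t = Reach? λ x y → R seq t x y ≟B true

    open NetSeq (netSeq c P? (λ t → Ball? t 2) (λ t → here)
      (λ t t≤M → Reach-sym λ {x} {y} e → trans (Rsym seq t t≤M y x) e)
      (λ t t<M → Reach-mono λ {x} {y} → Rmono seq t t<M x y))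

    O-unique : Unique (O 0)
    O-unique = AllPairs.map (λ { far refl → far (IsEquivalence.refl (equiv c 0 z≤n)) here }) (Net.separated (net 0 z≤n))

    -- Density puts an element of the net into every part, and the first partition is into
    -- singletons.
    O-complete : ∀ v → v ∈ O 0
    O-complete v with Net.dense (net 0 z≤n) v
    ... | inj₁ (s , s∈ , vs , _)           = subst (_∈ O 0) (≡-sym (single c v s vs)) s∈
    ... | inj₂ (s , _ , _ , (s∈ , vs) , _) = subst (_∈ O 0) (≡-sym (single c v s vs)) s∈

    ps : Vec (Fin n) n
    ps = proj₁ (positions O-unique O-complete)

    ps-pos : Positions (O 0) ps
    ps-pos = proj₂ (positions O-unique O-complete)

    O-prefix : ∀ t → t ≤ M → ∃ λ Y → O 0 ≡ O t ++ Y
    O-prefix zero    _   = [] , ≡-sym (++-identityʳ (O 0))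
    O-prefix (suc t) t<M with O-prefix t (<⇒≤ t<M) | nested t t<M
    ... | Y , eq | X , eq′ = X ++ Y , trans eq (trans (cong (_++ Y) eq′) (++-assoc (O (suc t)) X Y))

    -- A prefix lies between two consecutive nets, or it is so short that it lies in the last net,
    -- which has at most three elements.
    Between : ℕ → Set
    Between p = (∃ λ t → t < M × (∀ {w} → w ∈ O (suc t) → w ∈ take p (O 0)) × (∀ {w} → w ∈ take p (O 0) → w ∈ O t)) ⊎
      (∀ {w} → w ∈ take p (O 0) → w ∈ O M)

    -- The search goes up from `t` to the first net that fits into the prefix; `f` counts the
    -- remaining steps.
    between : ∀ p f t → t + f ≡ M → (∀ {w} → w ∈ take p (O 0) → w ∈ O t) → Between p
    between p zero    t eq ⊆Ot = inj₂ (subst (λ u → ∀ {w} → w ∈ take p (O 0) → w ∈ O u) (trans (≡-sym (+-identityʳ t)) eq) ⊆Ot)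
    between p (suc f) t eq ⊆Ot with O-prefix (suc t) t<M | length (O (suc t)) ≤? p
      where
      t<M : t < M
      t<M = ≤-trans (m≤m+n (suc t) f) (≤-reflexive (trans (≡-sym (+-suc t f)) eq))
    ... | Y , eqO | yes ≤p = inj₁ (t , ≤-trans (m≤m+n (suc t) f) (≤-reflexive (trans (≡-sym (+-suc t f)) eq)) ,
            (λ {w} w∈ → subst (λ L → w ∈ take p L) (≡-sym eqO) (prefix-⊆-take (O (suc t)) p ≤p w∈)) , ⊆Ot)
    ... | Y , eqO | no ≰p = between p f (suc t) (trans (≡-sym (+-suc t f)) eq)
            λ {w} w∈ → take-⊆-prefix (O (suc t)) p (<⇒≤ (≰⇒> ≰p)) (subst (λ L → w ∈ take p L) eqO w∈)

    order-width : ∀ i → 1 ≤ i → i ≤ n → ∀ v →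
      PartsLE (NS G (λ w → toℕ (lookup ps w) < n ∸ i)) (FlipBall (NS G (λ w → toℕ (lookup ps w) < n ∸ i)) G r v) (definableBound r d k)
    order-width i _ _ v = split (between p M 0 refl (take-⊆ p (O 0)))
      where
      p : ℕ
      p = n ∸ i
      take-⊆ : ∀ {w : Fin n} q xs → w ∈ take q xs → w ∈ xs
      take-⊆ q xs w∈ = proj₁ (∈-take⇒index< xs q w∈)
      S : Fin n → Set
      S w = toℕ (lookup ps w) < p
      S? : ∀ w → Dec (S w)
      S? w = suc (toℕ (lookup ps w)) ≤? p
      M≤bound : classBound d k ≤ definableBound r d k
      M≤bound = ≤-trans (≤-reflexive (≡-sym (*-identityˡ _))) (*-monoˡ-≤ (classBound d k) (m^n>0 (suc (classBound d k * classBound d k)) r))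
      split : Between p → PartsLE (NS G S) (FlipBall (NS G S) G r v) (definableBound r d k)
      split (inj₁ (t , t<M , lower , upper)) =
        flipBall-classes G (P? (suc t)) (equiv c (suc t) t<M) (Rsym seq (suc t) t<M) (homog seq (suc t) t<M) (net (suc t) t<M)
          S? (λ w∈ → proj₂ (proj₂ ps-pos) (lower w∈)) classes ≤-refl v
        where
        t≤M : t ≤ M
        t≤M = <⇒≤ t<M
        P-equiv : IsEquivalence (P c t)
        P-equiv = equiv c t t≤M
        classes : ∀ z → PartsLE (NS G S) (Ball (suc t) (r * 6) z) (classBound d k)
        classes z = PartsLE-coarsen proj₂
          (classes-≤ G noShatter (P? t) P-equiv S? (Ball? (suc t) (r * 6) z) T
            (All-tabulate (λ s∈ → proj₂ (∈-filter⁻ S? {xs = T₀} s∈)))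
            (≤-trans (length-filter S? T₀) (membersOf-length P-equiv (net t t≤M) L L≤k))
            (λ zx sx → in-T sx (Reach-≤ (n≤1+n _) zx)) far
            (L , L≤k , λ x zx → L-cov x (Reach-≤ (n≤1+n _) zx)))
          where
          L : List (Fin n)
          L = proj₁ (width t t<M z)
          L≤k : length L ≤ k
          L≤k = proj₁ (proj₂ (width t t<M z))
          L-cov : ∀ x → Ball (suc t) (suc (r * 6)) z x → Any (P c t x) L
          L-cov = proj₂ (proj₂ (width t t<M z))
          T₀ T : List (Fin n)
          T₀ = membersOf P-equiv (net t t≤M) L
          T  = filter S? T₀
          in-T : ∀ {s} → S s → Ball (suc t) (suc (r * 6)) z s → s ∈ T
          in-T {s} ss zs = ∈-filter⁺ S? (∈-membersOf P-equiv (net t t≤M) L (upper (proj₁ (proj₂ ps-pos) ss)) (L-cov s zs)) ss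
          far : ∀ {x x′ s} → Ball (suc t) (r * 6) z x → Ball (suc t) (r * 6) z x′ → P c t x x′ → S s → s ∉ T → adj G x s ≡ adj G x′ s
          far {x} {x′} {s} zx zx′ xx′ ss s∉ = homog seq (suc t) t<M x s x′ s (coarse c t t<M x x′ xx′)
              (IsEquivalence.refl (equiv c (suc t) t<M)) (apart zx) (apart zx′) (nonR zx) (nonR zx′)
            where
            apart : ∀ {y} → Ball (suc t) (r * 6) z y → y ≢ s
            apart zy refl = s∉ (in-T ss (Reach-≤ (n≤1+n _) zy))
            nonR : ∀ {y} → Ball (suc t) (r * 6) z y → R seq (suc t) y s ≡ false
            nonR {y} zy with R seq (suc t) y s in eq
            ... | false = refl
            ... | true  = contradiction (in-T ss (Reach-≤ (≤-reflexive (+-comm (r * 6) 1)) (Reach-trans zy (step eq here)))) s∉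
      -- At most three vertices define the partition here, and the count over the whole graph uses
      -- the single part of the last partition.
      split (inj₂ upper) = PartsLE-⊆ {X = λ _ → ⊤} _ (PartsLE-≤ (≤-trans (classBound-mono d 1≤k) M≤bound) (PartsLE-coarsen proj₂
        (classes-≤ G noShatter (P? M) P-equiv S? (λ _ → yes tt) T
          (All-tabulate (λ s∈ → proj₂ (∈-filter⁻ S? {xs = T₀} s∈)))
          (≤-trans (length-filter S? T₀) (membersOf-length P-equiv (net M ≤-refl) (v ∷ []) ≤-refl))
          (λ _ ss → in-T ss) (λ _ _ _ ss s∉ → contradiction (in-T ss) s∉)
          (v ∷ [] , ≤-refl , λ x _ → here (whole c x v)))))
        where
        P-equiv : IsEquivalence (P c M)
        P-equiv = equiv c M ≤-refl
        T₀ T : List (Fin n)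
        T₀ = membersOf P-equiv (net M ≤-refl) (v ∷ [])
        T  = filter S? T₀
        in-T : ∀ {s} → S s → s ∈ T
        in-T ss = ∈-filter⁺ S? (∈-membersOf P-equiv (net M ≤-refl) (v ∷ []) (upper (proj₁ (proj₂ ps-pos) ss)) (here (whole c _ v))) ss

-- The remaining comparisons of widths

¬¬-Fin : ∀ {n} {A : Fin n → Set} → (∀ i → ¬ ¬ A i) → ¬ ¬ (∀ i → A i)
¬¬-Fin {zero}  ¬¬a ¬all = ¬all λ ()
¬¬-Fin {suc n} ¬¬a ¬all = ¬¬a zero λ a → ¬¬-Fin (¬¬a ∘ suc) λ as → ¬all λ { zero → a ; (suc i) → as i }

¬¬-Dec₂ : ∀ {n} (P : Rel (Fin n) 0ℓ) → ¬ ¬ Dec₂ P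
¬¬-Dec₂ P = ¬¬-Fin λ x → ¬¬-Fin λ y → ¬¬-excluded-middle

module _ {n : ℕ} (G : Graph n) {P : Rel (Fin n) 0ℓ} (P-equiv : IsEquivalence P) (P? : Dec₂ P)
  {R : Fin n → Fin n → Bool} (R-sym : ∀ x y → R x y ≡ R y x) (homogeneous : Homogeneous G P R) where

  private
    Far : Rel (Fin n) 0ℓ
    Far x y = x ≢ y × R x y ≡ false

    Far? : Dec₂ Far
    Far? x y = ¬? (x ≟F y) ×-dec (R x y ≟B false)

    Far-sym : ∀ {x y} → Far x y → Far y x
    Far-sym {x} {y} (x≢y , e) = x≢y ∘ ≡-sym , trans (R-sym y x) e

  -- By homogeneity no two parts have pairs outside `R` of both kinds, so all edges of this flip
  -- belong to `R`.
  homogeneousFlip : Graph n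
  homogeneousFlip = farFlip G P-equiv P? Far? Far-sym

  homogeneousFlip-isFlip : IsFlip P G homogeneousFlip
  homogeneousFlip-isFlip = farFlip-isFlip G P-equiv P? Far? Far-sym

  homogeneousFlip-edge : ∀ {x y} → GEdge homogeneousFlip x y → BEdge R x y
  homogeneousFlip-edge {x} {y} e with R x y in eq
  ... | true  = refl
  ... | false with farFlip-edge G P-equiv P? Far? Far-sym (GEdge⇒≢ homogeneousFlip {x} {y} e , eq) e
  ...   | a , x₁ , y₁ , xx₁ , yy₁ , (x₁≢y₁ , eq₁) , a₁ = contradiction
          (trans (≡-sym a₁) (trans (≡-sym (homogeneous x y x₁ y₁ xx₁ yy₁ (GEdge⇒≢ homogeneousFlip {x} {y} e) x₁≢y₁ eq eq₁)) a)) true≢false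

-- Membership in a ball of `R` is decidable, hence stable under double negation, so a decision
-- procedure for the partition may be assumed to build the flip.
mw⇒pmw : ∀ {r k n} (G : Graph n) → mwLE r k G → pmwLE r k G
mw⇒pmw {r} G (S , width) = chain S , λ t t<m v → PartsLE-⊆ (inside t t<m v) (width t t<m v)
  where
  inside : ∀ t → t < m (chain S) → ∀ v {u} → FlipBall (P (chain S) (suc t)) G r v u → Reach (BEdge (R S (suc t))) r v u
  inside t t<m v {u} b = decidable-stable (Reach? (λ x y → R S (suc t) x y ≟B true) r v u) λ ¬reach →
    ¬¬-Dec₂ (P (chain S) (suc t)) λ P? →
      let E = equiv (chain S) (suc t) t<m ; s = Rsym S (suc t) t<m ; h = homog S (suc t) t<m in
      ¬reach (Reach-mono (homogeneousFlip-edge G E P? s h) (b (homogeneousFlip G E P? s h) (homogeneousFlip-isFlip G E P? s h)))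

tmw⇒pmw : ∀ {r k n} (G : Graph n) → tmwLE r k G → pmwLE r k G
tmw⇒pmw G (c , Gs , flips , width) = c , λ t t<m v →
  PartsLE-⊆ (λ b → b (Gs (suc t)) (flips (suc t) t<m)) (width t t<m v)

DecMW⇒mw : ∀ {r k n} (G : Graph n) → DecMW r k G → mwLE r k G
DecMW⇒mw G (S , _ , width) = S , width

DecMW⇒tmw : ∀ {r k n} (G : Graph n) → DecMW r k G → tmwLE r k G
DecMW⇒tmw {r} {n = n} G (S , P? , width) =
    chain S , (λ t → flipAt t (t ≤? M)) , (λ t t≤M → isFlipAt t (t ≤? M) t≤M) ,
    λ t t<M v → PartsLE-⊆ (Reach-mono (edgeAt (suc t) (suc t ≤? M) t<M)) (width t t<M v)
  where
  M : ℕ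
  M = m (chain S)
  flipAt : ∀ t → Dec (t ≤ M) → Graph n
  flipAt t (yes t≤M) = homogeneousFlip G (equiv (chain S) t t≤M) (P? t) (Rsym S t t≤M) (homog S t t≤M)
  flipAt t (no _)    = G
  isFlipAt : ∀ t t≤?M → t ≤ M → IsFlip (P (chain S) t) G (flipAt t t≤?M)
  isFlipAt t (yes t≤M) _   = homogeneousFlip-isFlip G (equiv (chain S) t t≤M) (P? t) (Rsym S t t≤M) (homog S t t≤M)
  isFlipAt t (no t≰M)  t≤M = contradiction t≤M t≰M
  edgeAt : ∀ t t≤?M → t ≤ M → ∀ {x y} → GEdge (flipAt t t≤?M) x y → BEdge (R S t) x y
  edgeAt t (yes t≤M) _   = homogeneousFlip-edge G (equiv (chain S) t t≤M) (P? t) (Rsym S t t≤M) (homog S t t≤M)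
  edgeAt t (no t≰M)  t≤M = contradiction t≤M t≰M

pmw⇒¬¬DecPMW : ∀ {r k n} (G : Graph n) → pmwLE r k G → ¬ ¬ DecPMW r k G
pmw⇒¬¬DecPMW {r} {k} {n} G (c , width) ¬dec =
    ¬¬-Fin (λ (i : Fin (suc M)) → ¬¬-Dec₂ (P c (toℕ i))) λ P? → ¬dec (c′ , dec P? , width′)
  where
  M : ℕ
  M = m c
  -- The chain is made constant from `M` on: decidability of finitely many partitions then covers
  -- every index.
  c′ : Chain n
  c′ = record
    { m      = M
    ; P      = λ t → P c (t ⊓ M)
    ; equiv  = λ t _ → equiv c (t ⊓ M) (m⊓n≤n t M)
    ; single = single c
    ; whole  = subst (λ t → ∀ x y → P c t x y) (≡-sym (⊓-idem M)) (whole c)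
    ; coarse = λ t t<M → subst₂ (λ u u′ → ∀ x y → P c u x y → P c u′ x y)
                 (≡-sym (m≤n⇒m⊓n≡m (<⇒≤ t<M))) (≡-sym (m≤n⇒m⊓n≡m t<M)) (coarse c t t<M)
    }
  dec : (∀ (i : Fin (suc M)) → Dec₂ (P c (toℕ i))) → DecChain c′
  dec P? t = subst (λ u → Dec₂ (P c u)) (toℕ-fromℕ< (s≤s (m⊓n≤n t M))) (P? (fromℕ< (s≤s (m⊓n≤n t M))))
  width′ : ∀ t → t < M → ∀ v → PartsLE (P c (t ⊓ M)) (FlipBall (P c (suc t ⊓ M)) G r v) k
  width′ t t<M v = subst₂ (λ u u′ → PartsLE (P c u) (FlipBall (P c u′) G r v) k)
    (≡-sym (m≤n⇒m⊓n≡m (<⇒≤ t<M))) (≡-sym (m≤n⇒m⊓n≡m t<M)) (width t t<M v)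

module _ {n : ℕ} (G : Graph n) {S S′ : Fin n → Set} (S? : ∀ x → Dec (S x)) (S′? : ∀ x → Dec (S′ x))
  (S∖S′-unique : ∀ {v w} → S v → ¬ S′ v → S w → ¬ S′ w → v ≡ w) where

  private
    module N = IsEquivalence (NS-isEquivalence G S′)

  -- The new vertex becomes a singleton, and every old class splits in two according to adjacency to
  -- it.
  PartsLE-addVertex : ∀ {X k} → PartsLE (NS G S′) X k → PartsLE (NS G S) X (suc (k * 2))
  PartsLE-addVertex {X} {k} (L , L≤k , cov) with any? (λ w → S? w ×-dec ¬? (S′? w))
  ... | no ¬new = L , ≤-trans L≤k (≤-trans (m≤m*n k 2) (n≤1+n (k * 2))) , λ x x∈X →
        Any.map (NS-antitone G (λ {w} s → decidable-stable (S′? w) λ ¬s′ → ¬new (w , s , ¬s′))) (cov x x∈X)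
  ... | yes (w , sw , ¬s′w) = w ∷ concatMap reps L , s≤s (≤-trans (length-concatMap-≤ reps L reps-length) (*-monoˡ-≤ 2 L≤k)) , cover
    where
    Rep : Fin n → Bool → Fin n → Set
    Rep y b x = NS G S′ y x × x ≢ w × adj G x w ≡ b
    Rep? : ∀ y b → Dec (∃ (Rep y b))
    Rep? y b = any? λ x → NS? G S′? y x ×-dec (¬? (x ≟F w) ×-dec (adj G x w ≟B b))
    choose : ∀ {y b} → Dec (∃ (Rep y b)) → List (Fin n)
    choose (yes (x , _)) = x ∷ []
    choose (no _)        = []
    choose-length : ∀ {y b} (d : Dec (∃ (Rep y b))) → length (choose d) ≤ 1
    choose-length (yes _) = ≤-refl
    choose-length (no _)  = z≤n
    reps : Fin n → List (Fin n)
    reps y = choose (Rep? y true) ++ choose (Rep? y false)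
    reps-length : ∀ y → length (reps y) ≤ 2
    reps-length y = ≤-trans (≤-reflexive (length-++ (choose (Rep? y true))))
      (+-mono-≤ (choose-length (Rep? y true)) (choose-length (Rep? y false)))
    chosen : ∀ {x y b} (d : Dec (∃ (Rep y b))) → Rep y b x → ∃ λ z → z ∈ choose d × Rep y b z
    chosen (yes (z , rep)) _   = z , here refl , rep
    chosen (no ¬rep)       rep = contradiction (_ , rep) ¬rep
    in-reps : ∀ {y z} b → z ∈ choose (Rep? y b) → z ∈ reps y
    in-reps true          = ∈-++⁺ˡ
    in-reps {y} false     = ∈-++⁺ʳ (choose (Rep? y true))
    refine : ∀ {x z} → NS G S′ x z → x ≢ w → z ≢ w → adj G x w ≡ adj G z w → NS G S x z
    refine (inj₁ eq)                _   _   _  = inj₁ eq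
    refine {x} {z} (inj₂ (¬s′x , ¬s′z , same)) x≢w z≢w eq = inj₂
      ((λ sx → x≢w (S∖S′-unique sx ¬s′x sw ¬s′w)) , (λ sz → z≢w (S∖S′-unique sz ¬s′z sw ¬s′w)) , same′)
      where
      same′ : ∀ u → S u → adj G x u ≡ adj G z u
      same′ u su with S′? u
      ... | yes s′u = same u s′u
      ... | no ¬s′u with refl ← S∖S′-unique su ¬s′u sw ¬s′w = eq
    cover : ∀ x → X x → Any (NS G S x) (w ∷ concatMap reps L)
    cover x x∈X with x ≟F w
    ... | yes eq = here (inj₁ eq)
    ... | no x≢w with find (cov x x∈X)
    ...   | y , y∈L , xy with chosen (Rep? y (adj G x w)) (N.sym xy , x≢w , refl)
    ...     | z , z∈ , yz , z≢w , eq =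
      there (lose (∈-concatMap reps y∈L (in-reps (adj G x w) z∈)) (refine (N.trans xy yz) x≢w z≢w (≡-sym eq)))

dmw⇒DecPMW : ∀ {r k n} (G : Graph n) → dmwLE r k G → DecPMW r (suc (k * 2)) G
dmw⇒DecPMW {r} {k} {n} G (lift (pos , pos-injective , width)) = c , P? , width′
  where
  S : ℕ → Fin n → Set
  S t w = toℕ (pos w) < n ∸ t
  S? : ∀ t w → Dec (S t w)
  S? t w = suc (toℕ (pos w)) ≤? n ∸ t
  P? : ∀ t → Dec₂ (NS G (S t))
  P? t = NS? G (S? t)
  S-all : ∀ w → S 0 w
  S-all w = toℕ<n (pos w)
  c : Chain n
  c = record
    { m      = n
    ; P      = λ t → NS G (S t)
    ; equiv  = λ t _ → NS-isEquivalence G (S t)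
    ; single = λ x y xy → NS-∈ G xy (S-all x)
    ; whole  = λ x y → inj₂ (empty x , empty y , λ w s → contradiction s (empty w))
    ; coarse = λ t _ x y → NS-antitone G λ s → ≤-trans s (∸-monoʳ-≤ n (n≤1+n t))
    }
    where
    empty : ∀ w → ¬ S n w
    empty w s = n≮0 (≤-trans s (≤-reflexive (n∸n≡0 n)))
  width′ : ∀ t → t < n → ∀ v → PartsLE (NS G (S t)) (FlipBall (NS G (S (suc t))) G r v) (suc (k * 2))
  -- Definable width counts the classes at `suc t`, the index of the ball, whereas here those at `t`
  -- are counted.
  width′ t t<n v = PartsLE-addVertex G (S? t) (S? (suc t))
      (λ {v} {w} sv ¬s′v sw ¬s′w → pos-injective (toℕ-injective (trans (last sv ¬s′v) (≡-sym (last sw ¬s′w)))))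
      (width (suc t) (s≤s z≤n) t<n v)
    where
    last : ∀ {w} → S t w → ¬ S (suc t) w → toℕ (pos w) ≡ n ∸ suc t
    last s ¬s′ = ≤-antisym (≤-pred (≤-trans s (≤-reflexive (+-∸-assoc 1 t<n)))) (≮⇒≥ ¬s′)

-- Deciding definable merge-width

pad : {A : Set} (a : A) (k : ℕ) (L : List A) → length L ≤ k → Σ (Vec A k) λ V → ∀ {Q : A → Set} → Any Q L → Any Q (toList V)
pad a zero    []      _         = [] , λ ()
pad a (suc k) []      _         = a ∷ proj₁ (pad a k [] z≤n) , λ ()
pad a (suc k) (x ∷ L) (s≤s L≤k) with pad a k L L≤k
... | V , sub = x ∷ V , λ { (here q) → here q ; (there q) → there (sub q) }

PartsLE? : ∀ {n} {P : Rel (Fin n) 0ℓ} {X : Fin n → Set} → Dec₂ P → (∀ x → Dec (X x)) → Fin n → ∀ k → Dec (PartsLE P X k)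
PartsLE? {n} {P} {X} P? X? v k = map′
  (λ { (V , cov) → toList V , ≤-reflexive (length-toList V) , cov })
  (λ { (L , L≤k , cov) → proj₁ (pad v k L L≤k) , λ x x∈X → proj₂ (pad v k L L≤k) (cov x x∈X) })
  (exhaust⇒∃? (exhaust-Vec (exhaust-Fin n) k) λ V → all? λ x → X? x →-dec Any.any? (P? x) (toList V))

definableOrder? : ∀ r k {n} (G : Graph n) → Dec (∃ (DefinableOrder r k G))
definableOrder? r k {n} G = exhaust⇒∃? (exhaust-Vec (exhaust-Fin n) n) λ ps →
  map′ (λ inj {x} {y} → inj x y) (λ inj x y → inj) (all? λ x → all? λ y → (lookup ps x ≟F lookup ps y) →-dec (x ≟F y))
  ×-dec
  map′ (λ w i 1≤i i≤n → w (s≤s i≤n) 1≤i) (λ w {i} i<1+n 1≤i → w i 1≤i (≤-pred i<1+n))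
    (allUpTo? (λ i → (1 ≤? i) →-dec all? λ v →
      let N? = NS? G (λ w → suc (toℕ (lookup ps w)) ≤? n ∸ i) in PartsLE? N? (flipBall? G N? r v) v k) (suc n))

definableOrder⇒dmw : ∀ {r k n} (G : Graph n) → ∃ (DefinableOrder r k G) → dmwLE r k G
definableOrder⇒dmw G (ps , injective , width) = lift (lookup ps , injective , width)

-- Boolean vectors and affine independence

vecs : ∀ N → List (Vec Bool N)
vecs zero    = [] ∷ []
vecs (suc N) = map (true ∷_) (vecs N) ++ map (false ∷_) (vecs N)

vecs-length : ∀ N → length (vecs N) ≡ 2 ^ N
vecs-length zero    = refl
vecs-length (suc N) = trans (length-++ (map (true ∷_) (vecs N))) (cong₂ _+_
  (trans (length-map _ (vecs N)) (vecs-length N))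
  (trans (length-map _ (vecs N)) (trans (vecs-length N) (≡-sym (+-identityʳ (2 ^ N))))))

∈-vecs : ∀ {N} (a : Vec Bool N) → a ∈ vecs N
∈-vecs []                  = here refl
∈-vecs (true ∷ a)          = ∈-++⁺ˡ (∈-map⁺ (true ∷_) (∈-vecs a))
∈-vecs {suc N} (false ∷ a) = ∈-++⁺ʳ (map (true ∷_) (vecs N)) (∈-map⁺ (false ∷_) (∈-vecs a))

vecs-unique : ∀ N → Unique (vecs N)
vecs-unique zero    = [] ∷ []
vecs-unique (suc N) = Uniqueₚ.++⁺ (Uniqueₚ.map⁺ ∷-injectiveʳ (vecs-unique N)) (Uniqueₚ.map⁺ ∷-injectiveʳ (vecs-unique N))
  λ { (p , q) → disjoint (∈-map⁻ (true ∷_) p) (∈-map⁻ (false ∷_) q) }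
  where
  disjoint : ∀ {a : Vec Bool (suc N)} → (∃ λ b → b ∈ vecs N × a ≡ true ∷ b) → (∃ λ b → b ∈ vecs N × a ≡ false ∷ b) → ⊥
  disjoint (_ , _ , refl) (_ , _ , ())

infixl 6 _⊕_

_⊕_ : ∀ {N} → Vec Bool N → Vec Bool N → Vec Bool N
_⊕_ = Vec.zipWith _xor_

⊕-cancel : ∀ {N} (e a : Vec Bool N) → e ⊕ (e ⊕ a) ≡ a
⊕-cancel []      []      = refl
⊕-cancel (x ∷ e) (y ∷ a) = cong₂ _∷_ (trans (≡-sym (xor-assoc x x y)) (cong (_xor y) (xor-same x))) (⊕-cancel e a)

⊕-cancelʳ : ∀ {N} (e a : Vec Bool N) → (e ⊕ a) ⊕ e ≡ a
⊕-cancelʳ []      []      = refl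
⊕-cancelʳ (x ∷ e) (y ∷ a) = cong₂ _∷_
  (trans (xor-comm (x xor y) x) (trans (≡-sym (xor-assoc x x y)) (cong (_xor y) (xor-same x)))) (⊕-cancelʳ e a)

⟨_,_⟩ : ∀ {N} → Vec Bool N → Vec Bool N → Bool
⟨ []    , []    ⟩ = false
⟨ x ∷ a , y ∷ b ⟩ = (x ∧ y) xor ⟨ a , b ⟩

⟨⟩-comm : ∀ {N} (a b : Vec Bool N) → ⟨ a , b ⟩ ≡ ⟨ b , a ⟩
⟨⟩-comm []      []      = refl
⟨⟩-comm (x ∷ a) (y ∷ b) = cong₂ _xor_ (∧-comm x y) (⟨⟩-comm a b)

xor-interchange : ∀ a b c d → (a xor b) xor (c xor d) ≡ (a xor c) xor (b xor d)
xor-interchange true  true  true  d     = refl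
xor-interchange true  true  false true  = refl
xor-interchange true  true  false false = refl
xor-interchange true  false true  true  = refl
xor-interchange true  false true  false = refl
xor-interchange true  false false d     = refl
xor-interchange false true  true  d     = refl
xor-interchange false true  false d     = refl
xor-interchange false false c     d     = refl

∧-distribʳ-xor : ∀ x y z → (x xor y) ∧ z ≡ (x ∧ z) xor (y ∧ z)
∧-distribʳ-xor false y     z     = refl
∧-distribʳ-xor true  false true  = refl
∧-distribʳ-xor true  false false = refl
∧-distribʳ-xor true  true  true  = refl
∧-distribʳ-xor true  true  false = refl

⟨⟩-⊕ : ∀ {N} (a e b : Vec Bool N) → ⟨ a ⊕ e , b ⟩ ≡ ⟨ a , b ⟩ xor ⟨ e , b ⟩
⟨⟩-⊕ []      []      []      = refl
⟨⟩-⊕ (x ∷ a) (y ∷ e) (z ∷ b) = trans (cong₂ _xor_ (∧-distribʳ-xor x y z) (⟨⟩-⊕ a e b)) (xor-interchange (x ∧ z) (y ∧ z) ⟨ a , b ⟩ ⟨ e , b ⟩)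

-- The head is the constant term of an affine function over 𝔽₂.
aff : ∀ {N} → Vec Bool (suc N) → Vec Bool N → Bool
aff (x ∷ d) b = x xor ⟨ d , b ⟩

aff-⊕ : ∀ {N} (a e : Vec Bool (suc N)) b → aff (a ⊕ e) b ≡ aff a b xor aff e b
aff-⊕ (x ∷ a) (y ∷ e) b = trans (cong ((x xor y) xor_) (⟨⟩-⊕ a e b)) (xor-interchange x y ⟨ a , b ⟩ ⟨ e , b ⟩)

map-aff-⊕ : ∀ {N j} (a e : Vec Bool (suc N)) (bs : Vec (Vec Bool N) j) →
  Vec.map (aff (a ⊕ e)) bs ≡ Vec.map (aff a) bs ⊕ Vec.map (aff e) bs
map-aff-⊕ a e []       = refl
map-aff-⊕ a e (b ∷ bs) = cong₂ _∷_ (aff-⊕ a e b) (map-aff-⊕ a e bs)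

tails : ∀ {N} → Bool → List (Vec Bool (suc N)) → List (Vec Bool N)
tails h []            = []
tails h ((x ∷ a) ∷ U) with x ≟B h
... | yes _ = a ∷ tails h U
... | no _  = tails h U

∈-tails⁻ : ∀ {N} h (U : List (Vec Bool (suc N))) {a} → a ∈ tails h U → (h ∷ a) ∈ U
∈-tails⁻ h ((x ∷ a) ∷ U) a∈ with x ≟B h
∈-tails⁻ h ((x ∷ a) ∷ U) (here refl) | yes refl = here refl
∈-tails⁻ h ((x ∷ a) ∷ U) (there a∈)  | yes refl = there (∈-tails⁻ h U a∈)
∈-tails⁻ h ((x ∷ a) ∷ U) a∈          | no _     = there (∈-tails⁻ h U a∈)

tails-unique : ∀ {N} h {U : List (Vec Bool (suc N))} → Unique U → Unique (tails h U)
tails-unique h {[]} [] = []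
tails-unique h {(x ∷ a) ∷ U} (a∉ ∷ u) with x ≟B h
... | yes refl = All-tabulate (λ { b∈ refl → All-lookup a∉ (∈-tails⁻ h U b∈) refl }) ∷ tails-unique h u
... | no _     = tails-unique h u

tails-length : ∀ {N} (U : List (Vec Bool (suc N))) → length U ≡ length (tails true U) + length (tails false U)
tails-length []                = refl
tails-length ((true ∷ a) ∷ U)  = cong suc (tails-length U)
tails-length ((false ∷ a) ∷ U) = trans (cong suc (tails-length U)) (≡-sym (+-suc (length (tails true U)) (length (tails false U))))

tails-length′ : ∀ {N} h (U : List (Vec Bool (suc N))) → length U ≡ length (tails h U) + length (tails (not h) U)
tails-length′ true  U = tails-length U
tails-length′ false U = trans (tails-length U) (+-comm (length (tails true U)) (length (tails false U)))

large-tails : ∀ {N} a (U : List (Vec Bool (suc N))) → a + a ≤ length U → ∃ λ h → a ≤ length (tails h U)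
large-tails a U a+a≤ with a ≤? length (tails true U)
... | yes a≤ = true , a≤
... | no a≰  = false , +-cancelˡ-≤ a _ _ (≤-trans a+a≤ (≤-trans (≤-reflexive (tails-length U)) (+-monoˡ-≤ _ (<⇒≤ (≰⇒> a≰)))))

-- Affine independence in dual form, which is the form used: affine functions take arbitrary values
-- on `bs`.
Independent : ∀ {N j} → Vec (Vec Bool N) j → Set
Independent bs = ∀ π → ∃ λ e → Vec.map (aff e) bs ≡ π

map-cong-∷ : ∀ {N j} h e (e′ : Vec Bool (suc (suc N))) (bs : Vec (Vec Bool N) j) → (∀ b → aff e′ (h ∷ b) ≡ aff e b) →
  Vec.map (aff e′) (Vec.map (h ∷_) bs) ≡ Vec.map (aff e) bs
map-cong-∷ h e e′ []       eq = refl
map-cong-∷ h e e′ (b ∷ bs) eq = cong₂ _∷_ (eq b) (map-cong-∷ h e e′ bs eq)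

lookup-map-∷ : ∀ {N j} h {U : List (Vec Bool (suc N))} (bs : Vec (Vec Bool N) j) → (∀ i → lookup bs i ∈ tails h U) →
  ∀ i → lookup (Vec.map (h ∷_) bs) i ∈ U
lookup-map-∷ h {U} bs bs∈ i = subst (_∈ U) (≡-sym (lookup-map i (h ∷_) bs)) (∈-tails⁻ h U (bs∈ i))

-- Split by the first coordinate. One half has at least `2 ^ j` elements; if the other is nonempty,
-- one of its vectors is added to independent ones from the large half, and otherwise the coordinate
-- is dropped.
independent : ∀ N j (U : List (Vec Bool N)) → Unique U → 2 ^ j ≤ length U →
  Σ (Vec (Vec Bool N) (suc j)) λ bs → (∀ i → lookup bs i ∈ U) × Independent bs
independent N zero (b ∷ U) _ _ = b ∷ [] , (λ { zero → here refl }) , λ { (x ∷ []) →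
  (x xor ⟨ zeros , b ⟩) ∷ zeros , cong (_∷ []) (trans (xor-assoc x _ _) (trans (cong (x xor_) (xor-same ⟨ zeros , b ⟩)) (xor-comm x false))) }
  where
  zeros : Vec Bool N
  zeros = Vec.replicate N false
independent zero (suc j) U u 2^j≤ = contradiction (≤-trans (m^n>0 2 (suc j)) 2^j≤) (small U u (≤-trans (*-monoʳ-≤ 2 (m^n>0 2 j)) 2^j≤))
  where
  small : ∀ (U : List (Vec Bool 0)) → Unique U → 2 ≤ length U → ¬ (1 ≤ length U)
  small ([] ∷ [] ∷ U) ((≢ ∷ _) ∷ _) _ _ = ≢ refl
  small ([] ∷ [])     _ (s≤s ())
independent (suc N) (suc j) U u 2^j≤ = choose (large-tails (2 ^ j) U (≤-trans (≤-reflexive (cong (2 ^ j +_) (≡-sym (+-identityʳ (2 ^ j))))) 2^j≤))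
  where
  Goal : Set
  Goal = Σ (Vec (Vec Bool (suc N)) (suc (suc j))) λ bs → (∀ i → lookup bs i ∈ U) × Independent bs

  keep-h : ∀ h x y → (x xor h) xor (h xor y) ≡ x xor y
  keep-h true  true  y = refl
  keep-h true  false true  = refl
  keep-h true  false false = refl
  keep-h false true  y = refl
  keep-h false false y = refl

  flip-h : ∀ h x y → (x xor h) xor (not h xor y) ≡ not (x xor y)
  flip-h true  true  true  = refl
  flip-h true  true  false = refl
  flip-h true  false y = refl
  flip-h false true  true  = refl
  flip-h false true  false = refl
  flip-h false false y = refl

  both : ∀ h → 2 ^ j ≤ length (tails h U) → ∀ b₁ → b₁ ∈ tails (not h) U → Goal
  both h big b₁ b₁∈ with independent N j (tails h U) (tails-unique h u) big
  ... | bs , bs∈ , ind = (not h ∷ b₁) ∷ Vec.map (h ∷_) bs ,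
      (λ { zero → ∈-tails⁻ (not h) U b₁∈ ; (suc i) → lookup-map-∷ h bs bs∈ i }) , ind′
    where
    ind′ : Independent ((not h ∷ b₁) ∷ Vec.map (h ∷_) bs)
    ind′ (π₁ ∷ π) with ind π
    ... | x ∷ d , eq with aff (x ∷ d) b₁ ≟B π₁
    ...   | yes e = x ∷ false ∷ d , cong₂ _∷_ e (trans (map-cong-∷ h (x ∷ d) (x ∷ false ∷ d) bs λ b → refl) eq)
    -- The sum of `h` and the first coordinate is added: it vanishes on the half `h` and is 1 at the
    -- added vector.
    ...   | no ne = (x xor h) ∷ true ∷ d ,
              cong₂ _∷_ (trans (flip-h h x ⟨ d , b₁ ⟩) (≢-≢⇒≡ (not-¬ refl ∘ ≡-sym) (ne ∘ ≡-sym)))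
                (trans (map-cong-∷ h (x ∷ d) ((x xor h) ∷ true ∷ d) bs λ b → keep-h h x ⟨ d , b ⟩) eq)

  one : ∀ h → tails (not h) U ≡ [] → Goal
  one h eq with independent N (suc j) (tails h U) (tails-unique h u)
      (≤-trans 2^j≤ (≤-reflexive (trans (tails-length′ h U) (trans (cong (λ L → length (tails h U) + length L) eq) (+-identityʳ _)))))
  ... | bs , bs∈ , ind = Vec.map (h ∷_) bs , lookup-map-∷ h bs bs∈ , ind′
    where
    ind′ : Independent (Vec.map (h ∷_) bs)
    ind′ π with ind π
    ... | x ∷ d , e = x ∷ false ∷ d , trans (map-cong-∷ h (x ∷ d) (x ∷ false ∷ d) bs λ b → refl) e

  choose : ∃ (λ h → 2 ^ j ≤ length (tails h U)) → Goal
  choose (h , big) with tails (not h) U in eq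
  ... | []     = one h eq
  ... | b ∷ _  = both h big b (subst (b ∈_) (≡-sym eq) (here refl))

-- A bipartite pattern of large partition width

-- The inner product of the tails plus both heads. It is symmetric, and affine in either tail once
-- the heads are fixed.
biadj : ∀ {N} → Vec Bool (suc N) → Vec Bool (suc N) → Bool
biadj a (y ∷ b) = y xor aff a b

biadj-comm : ∀ {N} (a b : Vec Bool (suc N)) → biadj a b ≡ biadj b a
biadj-comm (x ∷ a) (y ∷ b) = trans (≡-sym (xor-assoc y x ⟨ a , b ⟩))
  (trans (cong₂ _xor_ (xor-comm y x) (⟨⟩-comm a b)) (xor-assoc x y ⟨ b , a ⟩))

⟨⟩-nondegenerate : ∀ {N} (b b′ : Vec Bool N) → (∀ a → ⟨ a , b ⟩ ≡ ⟨ a , b′ ⟩) → b ≡ b′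
⟨⟩-nondegenerate []      []        eq = refl
⟨⟩-nondegenerate {suc N} (y ∷ b) (y′ ∷ b′) eq with refl ← ⟨⟩-nondegenerate b b′ (λ a → eq (false ∷ a)) =
  cong (_∷ b) (xor-cancelʳ (eq (true ∷ Vec.replicate N false)))
  where
  xor-cancelʳ : ∀ {x y z} → x xor z ≡ y xor z → x ≡ y
  xor-cancelʳ {true}  {true}          _ = refl
  xor-cancelʳ {false} {false}         _ = refl
  xor-cancelʳ {true}  {false} {true}  ()
  xor-cancelʳ {true}  {false} {false} ()
  xor-cancelʳ {false} {true}  {true}  ()
  xor-cancelʳ {false} {true}  {false} ()

biadj-nondegenerate : ∀ {N} (b b′ : Vec Bool (suc N)) → (∀ a → biadj a b ≡ biadj a b′) → b ≡ b′
biadj-nondegenerate {N} b b′ eq = helper b b′ (λ a → trans (biadj-comm b a) (trans (eq a) (biadj-comm a b′)))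
  where
  zeros : Vec Bool N
  zeros = Vec.replicate N false
  ⟨⟩-zeros : ∀ {N} (b : Vec Bool N) → ⟨ b , Vec.replicate N false ⟩ ≡ false
  ⟨⟩-zeros []          = refl
  ⟨⟩-zeros (true ∷ b)  = ⟨⟩-zeros b
  ⟨⟩-zeros (false ∷ b) = ⟨⟩-zeros b
  xor-cancelˡ : ∀ x {y z} → x xor y ≡ x xor z → y ≡ z
  xor-cancelˡ true  = not-injective
  xor-cancelˡ false eq = eq
  helper : ∀ b b′ → (∀ a → biadj b a ≡ biadj b′ a) → b ≡ b′
  helper (y ∷ b) (y′ ∷ b′) eq with y≡y′
    where
    y≡y′ : y ≡ y′
    y≡y′ = trans (≡-sym (trans (cong (y xor_) (⟨⟩-zeros b)) (xor-identityʳ y)))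
      (trans (eq (false ∷ zeros)) (trans (cong (y′ xor_) (⟨⟩-zeros b′)) (xor-identityʳ y′)))
  ... | refl = cong (y ∷_) (⟨⟩-nondegenerate b b′ λ a →
      trans (⟨⟩-comm a b) (trans (xor-cancelˡ y (eq (false ∷ a))) (⟨⟩-comm b′ a)))

separate : {A : Set} {Q Q′ : A → Set} (Z : List A) → Unique Z → All (λ z → Q z ⊎ Q′ z) Z →
  Σ (List A) λ U → Σ (List A) λ V → Unique U × Unique V × All Q U × All Q′ V ×
    (∀ {z} → z ∈ U → z ∈ Z) × (∀ {z} → z ∈ V → z ∈ Z) × length Z ≡ length U + length V
separate []      []       []       = [] , [] , [] , [] , [] , [] , (λ ()) , (λ ()) , refl
separate (z ∷ Z) (z∉ ∷ u) (q ∷ qs) with separate Z u qs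
separate (z ∷ Z) (z∉ ∷ u) (inj₁ q ∷ qs) | U , V , uU , uV , qU , qV , U⊆ , V⊆ , len =
  z ∷ U , V , All-tabulate (λ w∈ → All-lookup z∉ (U⊆ w∈)) ∷ uU , uV , q ∷ qU , qV ,
  (λ { (here eq) → here eq ; (there w∈) → there (U⊆ w∈) }) , (there ∘ V⊆) , cong suc len
separate (z ∷ Z) (z∉ ∷ u) (inj₂ q ∷ qs) | U , V , uU , uV , qU , qV , U⊆ , V⊆ , len =
  U , z ∷ V , uU , All-tabulate (λ w∈ → All-lookup z∉ (V⊆ w∈)) ∷ uV , qU , q ∷ qV ,
  (there ∘ U⊆) , (λ { (here eq) → here eq ; (there w∈) → there (V⊆ w∈) }) , trans (cong suc len) (≡-sym (+-suc (length U) (length V)))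

-- Pigeonhole principle; the witnesses in `Any` provide the assignment, since `Q` comes without a
-- decision procedure.
large-fibre : {A B : Set} {Q : A → B → Set} (c : ℕ) (L : List B) (Z : List A) → Unique Z → All (λ z → Any (Q z) L) Z →
  length L * c < length Z → ∃ λ y → Σ (List A) λ U → Unique U × suc c ≤ length U × All (λ z → Q z y) U
large-fibre c []      (z ∷ Z) _ (() ∷ _) _
large-fibre c (y ∷ L) Z u cov L<Z with separate Z u (All-map (λ { (here q) → inj₁ q ; (there q) → inj₂ q }) cov)
... | U , V , uU , uV , qU , qV , _ , _ , len with suc c ≤? length U
...   | yes c<U = y , U , uU , c<U , qU
...   | no c≮U  = large-fibre c L V uV qV (+-cancelˡ-< c _ _ (≤-trans L<Z
          (≤-trans (≤-reflexive len) (+-monoˡ-≤ (length V) (≤-pred (≰⇒> c≮U))))))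

Crowded : ∀ {n N} → Rel (Fin n) 0ℓ → (Vec Bool N → Fin n) → Set
Crowded {N = N} P γ = ∃ λ v → Σ (List (Vec Bool N)) λ U → Unique U × 16 ≤ length U × All (λ j → P (γ j) v) U

module _ {n N : ℕ} (H : Graph n) {α β : Vec Bool (suc N) → Fin n}
  (adj-βα : ∀ a b → adj H (β a) (α b) ≡ biadj a b) (β≢α : ∀ a b → β a ≢ α b) where

  private
    -- The four positions realise all pairs of bits, hence answer all choices of flip bits for two
    -- vertices against one part.
    c₁ c₂ : Vec Bool 4
    c₁ = true ∷ true  ∷ false ∷ false ∷ []
    c₂ = true ∷ false ∷ true  ∷ false ∷ []

    all-patterns : ∀ p q → ∃ λ l → lookup c₁ l ≡ p × lookup c₂ l ≡ q
    all-patterns true  true  = zero , refl , refl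
    all-patterns true  false = suc zero , refl , refl
    all-patterns false true  = suc (suc zero) , refl , refl
    all-patterns false false = suc (suc (suc zero)) , refl , refl

    xor-not-≢ : ∀ h f → h xor not (h xor f) ≢ f
    xor-not-≢ true  true  ()
    xor-not-≢ true  false ()
    xor-not-≢ false true  ()
    xor-not-≢ false false ()

  -- Sixteen vectors contain four affinely independent ones. If their α-images share a part, then a sixteenth
  -- of all β-images sees them in pattern c₂ and is joined, in every flip, to one that sees them in pattern c₁.
  crowd-step : ∀ {P P′ : Rel (Fin n) 0ℓ} {k} → IsEquivalence P′ → (∀ v → PartsLE P (FlipBall P′ H 2 v) k) →
    240 * k < 2 ^ suc N → Crowded P′ α → Crowded P β
  crowd-step {P} {P′} {k} P′-equiv width 240k< (v , U , uU , 16≤U , αU)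
    -- Eight of the sixteen vectors share the head `h`, and among `2 ^ 3` tails four are affinely
    -- independent.
    with large-tails 8 U 16≤U
  ... | h , 8≤ with independent N 3 (tails h U) (tails-unique h uU) 8≤
  ... | bs , bs∈ , ind with ind c₁ | width (β (proj₁ (ind c₁)))
  ... | e₁ , e₁-pat | L , L≤k , L-cov = large-fibre 15 L Z Z-unique
      (All-tabulate λ {i} i∈ → L-cov (β i) (connected i (proj₂ (∈-filter⁻ hasPattern? {xs = vecs (suc N)} i∈)))) L<Z
    where
    module P′ = IsEquivalence P′-equiv

    hasPattern? : ∀ i → Dec (Vec.map (aff i) bs ≡ c₂)
    hasPattern? i = Vec-≡-dec _≟B_ (Vec.map (aff i) bs) c₂

    Z : List (Vec Bool (suc N))
    Z = filter hasPattern? (vecs (suc N))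

    Z-unique : Unique Z
    Z-unique = Uniqueₚ.filter⁺ hasPattern? (vecs-unique (suc N))

    e : Vec Bool 4 → Vec Bool (suc N)
    e π = proj₁ (ind π)

    -- Translation by `e π` changes patterns by `π`, so the sixteen translates of `Z` exhaust all
    -- vectors.
    covering : ∀ {i} → i ∈ vecs (suc N) → i ∈ concatMap (λ π → map (e π ⊕_) Z) (vecs 4)
    covering {i} _ = ∈-concatMap (λ π → map (e π ⊕_) Z) (∈-vecs π)
        (subst (_∈ map (e π ⊕_) Z) (⊕-cancel (e π) i) (∈-map⁺ (e π ⊕_) (∈-filter⁺ hasPattern? (∈-vecs (e π ⊕ i)) pattern-z)))
      where
      π : Vec Bool 4
      π = Vec.map (aff i) bs ⊕ c₂
      pattern-z : Vec.map (aff (e π ⊕ i)) bs ≡ c₂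
      pattern-z = trans (map-aff-⊕ (e π) i bs) (trans (cong (_⊕ Vec.map (aff i) bs) (proj₂ (ind π))) (⊕-cancelʳ (Vec.map (aff i) bs) c₂))

    2^N≤ : 2 ^ suc N ≤ 16 * length Z
    2^N≤ = ≤-trans (≤-reflexive (≡-sym (vecs-length (suc N)))) (≤-trans (unique-length-≤ (vecs-unique (suc N)) covering)
      (length-concatMap-≤ (λ π → map (e π ⊕_) Z) (vecs 4) λ π → ≤-reflexive (length-map (e π ⊕_) Z)))

    L<Z : length L * 15 < length Z
    L<Z = *-cancelˡ-< 16 _ _ (≤-trans (s≤s (≤-trans (*-monoʳ-≤ 16 (*-monoˡ-≤ 15 L≤k)) (≤-reflexive 16k15≡)))
        (≤-trans 240k< 2^N≤))
      where
      16k15≡ : 16 * (k * 15) ≡ 240 * k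
      16k15≡ = trans (cong (16 *_) (*-comm k 15)) (≡-sym (*-assoc 16 15 k))

    connected : ∀ i → Vec.map (aff i) bs ≡ c₂ → FlipBall P′ H 2 (β e₁) (β i)
    -- On the crowded part the flip bit depends only on the `β`-vertex. Some `l` makes both
    -- adjacencies differ from their bits, so `α j` is a common neighbour in the flip.
    connected i i-pat G′ (F , Fsym , Finv , F-adj)
      with all-patterns (not (h xor F (β e₁) v)) (not (h xor F (β i) v))
    ... | l , eq₁ , eq₂ = step (edge e₁ (trans (pat e₁ e₁-pat) eq₁)) (step (GEdge-sym G′ (edge i (trans (pat i i-pat) eq₂))) here)
      where
      j : Vec Bool (suc N)
      j = h ∷ lookup bs l
      pat : ∀ a {c} → Vec.map (aff a) bs ≡ c → aff a (lookup bs l) ≡ lookup c l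
      pat a refl = ≡-sym (lookup-map l (aff a) bs)
      αj∼v : P′ (α j) v
      αj∼v = All-lookup αU (∈-tails⁻ h U (bs∈ l))
      edge : ∀ a → aff a (lookup bs l) ≡ not (h xor F (β a) v) → GEdge G′ (β a) (α j)
      edge a eq = trans (F-adj (β a) (α j) (β≢α a j)) (xor-≢ λ eq′ → xor-not-≢ h (F (β a) v)
        (trans (cong (h xor_) (≡-sym eq)) (trans (≡-sym (adj-βα a j)) (trans eq′ (Finv (β a) (β a) (α j) v P′.refl αj∼v)))))

module _ {n N : ℕ} (H : Graph n) {α β : Vec Bool (suc N) → Fin n}
  (adj-αβ : ∀ a b → adj H (α a) (β b) ≡ biadj a b) (α≢β : ∀ a b → α a ≢ β b)
  (α-injective : Injective _≡_ _≡_ α) (β-injective : Injective _≡_ _≡_ β) where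

  private
    not-crowded-single : ∀ {γ : Vec Bool (suc N) → Fin n} {P : Rel (Fin n) 0ℓ} → Injective _≡_ _≡_ γ →
      (∀ x y → P x y → x ≡ y) → ¬ Crowded P γ
    not-crowded-single inj single (v , j ∷ j′ ∷ _ , (j≢ ∷ _) ∷ _ , _ , p ∷ p′ ∷ _) =
      j≢ (inj (trans (single _ _ p) (≡-sym (single _ _ p′))))
    not-crowded-single inj single (v , _ ∷ [] , _ , s≤s () , _)

    adj-βα : ∀ a b → adj H (β a) (α b) ≡ biadj a b
    adj-βα a b = trans (sym H (β a) (α b)) (trans (adj-αβ b a) (biadj-comm b a))

  -- If one side is crowded at `suc t`, the other is crowded at `t`. The last partition is crowded
  -- and singletons are not.
  biadj-pmw : ∀ {k} → 16 ≤ 2 ^ suc N → 240 * k < 2 ^ suc N → ¬ pmwLE 2 k H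
  biadj-pmw {k} 16≤ 240k< (c , width) = proj₁ (never (m c) ≤-refl) (v , vecs (suc N) , vecs-unique (suc N) ,
      ≤-trans 16≤ (≤-reflexive (≡-sym (vecs-length (suc N)))) , All-tabulate λ _ → whole c _ v)
    where
    v : Fin n
    v = α (Vec.replicate (suc N) false)
    never : ∀ t → t ≤ m c → ¬ Crowded (P c t) α × ¬ Crowded (P c t) β
    never zero    _   = not-crowded-single α-injective (single c) , not-crowded-single β-injective (single c)
    never (suc t) t<m with never t (<⇒≤ t<m)
    ... | ¬α , ¬β = (λ cr → ¬β (crowd-step H adj-βα (λ a b → α≢β b a ∘ ≡-sym) (equiv c (suc t) t<m) (width t t<m) 240k< cr)) ,
                    (λ cr → ¬α (crowd-step H adj-αβ α≢β (equiv c (suc t) t<m) (width t t<m) 240k< cr))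

-- Bounded VC-dimension

shattered-width : ∀ w {N} → suc (suc N) ≡ w + w → 10 ≤ w → ∀ k → k ^ 2 ≤ 2 ^ suc N + 2 ^ suc N → 240 * k < 2 ^ suc N
shattered-width w {N} N+2≡ 10≤w k k²≤ = begin-strict
  240 * k        ≤⟨ *-monoʳ-≤ 240 k≤ ⟩
  240 * 2 ^ w    <⟨ *-monoˡ-< (2 ^ w) {{>-nonZero (m^n>0 2 w)}} {240} {256} (s≤s (m≤m+n 240 15)) ⟩
  2 ^ 8 * 2 ^ w  ≡⟨ ^-distribˡ-+-* 2 8 w ⟨
  2 ^ (8 + w)    ≤⟨ ^-monoʳ-≤ 2 8+w≤ ⟩
  2 ^ suc N      ∎
  where
  open ≤-Reasoning
  8+w≤ : 8 + w ≤ suc N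
  8+w≤ = ≤-pred (≤-trans (≤-trans (n≤1+n (9 + w)) (+-monoˡ-≤ w 10≤w)) (≤-reflexive (≡-sym N+2≡)))
  -- The left side is the number of vertices of the pattern; a width at most its square root is at
  -- most `2 ^ w`, and `240 < 2 ^ 8`.
  square : 2 ^ suc N + 2 ^ suc N ≡ (2 ^ w) ^ 2
  square = trans (cong (2 ^ suc N +_) (≡-sym (+-identityʳ _))) (trans (cong (2 ^_) N+2≡)
    (trans (cong (2 ^_) (trans (cong (w +_) (≡-sym (+-identityʳ w))) (*-comm 2 w))) (≡-sym (^-*-assoc 2 w 2))))
  k≤ : k ≤ 2 ^ w
  k≤ with k ≤? 2 ^ w
  ... | yes k≤ = k≤
  ... | no k≰  = contradiction (≤-trans k²≤ (≤-reflexive square)) (<⇒≱ (^-monoˡ-< 2 (≰⇒> k≰)))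

n≤2^n : ∀ n → n ≤ 2 ^ n
n≤2^n zero    = z≤n
n≤2^n (suc n) = ≤-trans (+-mono-≤ (m^n>0 2 n) (n≤2^n n)) (≤-reflexive (cong (2 ^ n +_) (≡-sym (+-identityʳ (2 ^ n)))))

module _ {C : GraphClass} (hereditary : Hereditary C) (almost : AlmostBounded pmwLE C) where

  private
    n₀ : ℕ
    n₀ = proj₁ (almost 2 1)

  -- The entries of `T` are indexed by vectors, and shattering gives for each `b` a vertex whose
  -- trace on `T` is `biadj` with `b`. These vertices are distinct by nondegeneracy, so heredity
  -- puts the pattern into the class, contrary to `biadj-pmw`.
  noShatter-dimension : ∀ {w N} → suc (suc N) ≡ w + w → 10 ≤ w → n₀ ≤ w →
    ∀ {n} (G : Graph n) → C n G → NoShatter G (length (vecs (suc N)))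
  noShatter-dimension {w} {N} N+2≡ 10≤w n₀≤w {n} G CG {Y} {S} T T⊆S Y∩S shat =
      biadj-pmw H adj-αβ α≢β α-injective β-injective 16≤ (shattered-width w N+2≡ 10≤w k k²≤) pmw
    where
    V : List (Vec Bool (suc N))
    V = vecs (suc N)
    d : ℕ
    d = length V
    at : Fin d → Vec Bool (suc N)
    at = Data.List.lookup V
    idx : Vec Bool (suc N) → Fin d
    idx a = Any.index (∈-vecs a)
    at-idx : ∀ a → at (idx a) ≡ a
    at-idx a = ≡-sym (Anyₚ.lookup-index (∈-vecs a))
    idx-injective : Injective _≡_ _≡_ idx
    idx-injective {a} {b} eq = trans (≡-sym (at-idx a)) (trans (cong at eq) (at-idx b))
    at-injective : ∀ {i j} → at i ≡ at j → i ≡ j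
    at-injective {i} {j} eq = trans (≡-sym (index-lookup V i)) (trans
      (unique-index (vecs-unique (suc N)) (∈-lookup i) (∈-lookup j) eq) (index-lookup V j))

    realise : (Fin d → Bool) → Fin n
    realise f = proj₁ (shat (tabulate f))
    realise-adj : ∀ f i → adj G (realise f) (lookup T i) ≡ f i
    realise-adj f i = trans (≡-sym (lookup-map i (adj G (realise f)) T)) (trans
      (cong (λ v → lookup v i) (proj₂ (proj₂ (shat (tabulate f))))) (lookup∘tabulate f i))
    f : Vec Bool (suc N) → Fin n
    f b = realise λ i → biadj (at i) b
    f-adj : ∀ b i → adj G (f b) (lookup T i) ≡ biadj (at i) b
    f-adj b = realise-adj λ i → biadj (at i) b
    T≢f : ∀ i b → lookup T i ≢ f b
    T≢f i b eq = Y∩S (f b) (proj₁ (proj₂ (shat (tabulate λ i → biadj (at i) b)))) (subst S eq (T⊆S i))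

    -- The vertex whose trace is the indicator of `i` tells the entries apart.
    T-injective : ∀ {i j} → lookup T i ≡ lookup T j → i ≡ j
    T-injective {i} {j} eq = ≡-sym (⌊⌋≡true⇒ (j ≟F i) (trans (≡-sym (realise-adj g j))
        (trans (cong (adj G (realise g)) (≡-sym eq)) (trans (realise-adj g i) (⇒⌊⌋≡true (i ≟F i) refl)))))
      where
      g : Fin d → Bool
      g l = ⌊ l ≟F i ⌋
    f-injective : ∀ {b b′} → f b ≡ f b′ → b ≡ b′
    f-injective {b} {b′} eq = biadj-nondegenerate b b′ λ a → subst (λ a → biadj a b ≡ biadj a b′) (at-idx a)
      (trans (≡-sym (f-adj b (idx a))) (trans (cong (λ x → adj G x (lookup T (idx a))) eq) (f-adj b′ (idx a))))

    h′ : Fin d ⊎ Fin d → Fin n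
    h′ (inj₁ i) = lookup T i
    h′ (inj₂ j) = f (at j)
    h′-injective : ∀ {x y} → h′ x ≡ h′ y → x ≡ y
    h′-injective {inj₁ _} {inj₁ _} eq = cong inj₁ (T-injective eq)
    h′-injective {inj₁ i} {inj₂ j} eq = contradiction eq (T≢f i (at j))
    h′-injective {inj₂ i} {inj₁ j} eq = contradiction (≡-sym eq) (T≢f j (at i))
    h′-injective {inj₂ i} {inj₂ j} eq = cong inj₂ (at-injective (f-injective {at i} {at j} eq))
    h : Fin (d + d) → Fin n
    h x = h′ (splitAt d x)
    h-injective : Injective _≡_ _≡_ h
    h-injective {x} {y} eq = trans (≡-sym (join-splitAt d d x)) (trans (cong (join d d) (h′-injective {splitAt d x} {splitAt d y} eq)) (join-splitAt d d y))

    H : Graph (d + d)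
    H = induce G h

    α β : Vec Bool (suc N) → Fin (d + d)
    α a = idx a ↑ˡ d
    β b = d ↑ʳ idx b
    hα : ∀ a → h (α a) ≡ lookup T (idx a)
    hα a = cong h′ (splitAt-↑ˡ d (idx a) d)
    hβ : ∀ b → h (β b) ≡ f b
    hβ b = trans (cong h′ (splitAt-↑ʳ d d (idx b))) (cong f (at-idx b))
    α≢β : ∀ a b → α a ≢ β b
    α≢β a b eq = T≢f (idx a) b (trans (≡-sym (hα a)) (trans (cong h eq) (hβ b)))
    α-injective : Injective _≡_ _≡_ α
    α-injective eq = idx-injective (↑ˡ-injective d _ _ eq)
    β-injective : Injective _≡_ _≡_ β
    β-injective eq = idx-injective (↑ʳ-injective d _ _ eq)
    adj-αβ : ∀ a b → adj H (α a) (β b) ≡ biadj a b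
    adj-αβ a b = trans (cong₂ (adj G) (hα a) (hβ b)) (trans (sym G (lookup T (idx a)) (f b))
      (trans (f-adj b (idx a)) (cong (λ a → biadj a b) (at-idx a))))

    N≥ : 9 + w ≤ suc N
    N≥ = ≤-pred (≤-trans (+-monoˡ-≤ w 10≤w) (≤-reflexive (≡-sym N+2≡)))
    16≤ : 16 ≤ 2 ^ suc N
    16≤ = ^-monoʳ-≤ 2 {4} (≤-trans (≤-trans (m≤m+n 4 5) (m≤m+n 9 w)) N≥)
    n₀≤ : n₀ ≤ d + d
    n₀≤ = ≤-trans n₀≤w (≤-trans (≤-trans (m≤n+m w 9) N≥) (≤-trans (n≤2^n (suc N))
      (≤-trans (≤-reflexive (≡-sym (vecs-length (suc N)))) (m≤m+n d d))))
    bounded : Σ ℕ λ k → k ^ 2 ≤ d + d × pmwLE 2 k H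
    bounded = proj₂ (almost 2 1) (d + d) n₀≤ H (hereditary G h h-injective CG)
    k : ℕ
    k = proj₁ bounded
    k²≤ : k ^ 2 ≤ 2 ^ suc N + 2 ^ suc N
    k²≤ = ≤-trans (proj₁ (proj₂ bounded)) (≤-reflexive (cong₂ _+_ (vecs-length (suc N)) (vecs-length (suc N))))
    pmw : pmwLE 2 k H
    pmw = proj₂ (proj₂ bounded)

  noShatter : ∃ λ d → ∀ {n} (G : Graph n) → C n G → NoShatter G d
  noShatter = length (vecs (suc (w + w))) ,
      noShatter-dimension {suc w} {w + w} (cong suc (≡-sym (+-suc w w))) (s≤s (m≤n+m 9 n₀)) (≤-trans (m≤m+n n₀ 9) (n≤1+n w))
    where
    w : ℕ
    w = n₀ + 9

-- Polynomial losses are harmless for almost boundedness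

-- Powers absorb constants and sums from 2 on; this is why the width enters below as `2 + k`.
PolyBounded : (ℕ → ℕ) → Set
PolyBounded f = ∃ λ e → ∀ K → 2 ≤ K → f K ≤ K ^ e

poly-id : PolyBounded λ K → K
poly-id = 1 , λ K _ → ≤-reflexive (≡-sym (*-identityʳ K))

poly-const : ∀ c → PolyBounded λ _ → c
poly-const c = c , λ K 2≤K → ≤-trans (n≤2^n c) (^-monoˡ-≤ c 2≤K)

poly-* : ∀ {f g} → PolyBounded f → PolyBounded g → PolyBounded λ K → f K * g K
poly-* (a , f≤) (b , g≤) = a + b , λ K 2≤K →
  ≤-trans (*-mono-≤ (f≤ K 2≤K) (g≤ K 2≤K)) (≤-reflexive (≡-sym (^-distribˡ-+-* K a b)))

poly-+ : ∀ {f g} → PolyBounded f → PolyBounded g → PolyBounded λ K → f K + g K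
poly-+ {f} {g} (a , f≤) (b , g≤) = suc (a + b) , bound
  where
  bound : ∀ K → 2 ≤ K → f K + g K ≤ K ^ suc (a + b)
  bound K@(suc _) 2≤K = begin
    f K + g K                    ≤⟨ +-mono-≤ (f≤ K 2≤K) (g≤ K 2≤K) ⟩
    K ^ a + K ^ b                ≤⟨ +-mono-≤ (^-monoʳ-≤ K (m≤m+n a b)) (^-monoʳ-≤ K (m≤n+m b a)) ⟩
    K ^ (a + b) + K ^ (a + b)    ≡⟨ cong (K ^ (a + b) +_) (+-identityʳ _) ⟨
    2 * K ^ (a + b)              ≤⟨ *-monoˡ-≤ (K ^ (a + b)) 2≤K ⟩
    K ^ suc (a + b)              ∎
    where open ≤-Reasoning

poly-^ : ∀ {f} d → PolyBounded f → PolyBounded λ K → f K ^ d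
poly-^ d (a , f≤) = a * d , λ K 2≤K → ≤-trans (^-monoˡ-≤ d (f≤ K 2≤K)) (≤-reflexive (^-*-assoc K a d))

poly-classBound : ∀ d {f} → PolyBounded f → PolyBounded λ K → classBound d (f K)
poly-classBound d pf = poly-+ 3f (poly-* pf (poly-^ d (poly-+ (poly-const 1) (poly-* (poly-const 2) 3f))))
  where 3f = poly-* pf (poly-const 3)

poly-definableBound : ∀ r d {f} → PolyBounded f → PolyBounded λ K → definableBound r d (f K)
poly-definableBound r d pf = poly-* (poly-^ r (poly-+ (poly-const 1) (poly-* cf cf))) cf
  where cf = poly-classBound d pf

-- With `E = e * suc q`, the hypothesis is used for the exponent `1 / (2E + 1)`. For `k` at least 2,
-- `2 + k` is at most the square of `k`; for smaller `k`, `3 ^ E` is a sufficient threshold for `n`.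
almostBounded-transfer : {C : GraphClass} {W W′ : WidthLE} →
  (∀ r → ∃ λ r′ → ∃ λ f → PolyBounded f ×
    (∀ {n} (G : Graph n) → C n G → ∀ {k} → W r′ k G → W′ r (f (2 + k)) G)) →
  AlmostBounded W C → AlmostBounded W′ C
almostBounded-transfer {C} {W} {W′} transfer almost r q with transfer r
... | r′ , f , (e , f≤) , W⇒W′ with almost r′ (2 * (e * suc q))
...   | n₀ , bounded = n₀ + 3 ^ E , λ n n₀≤n G CG → result n n₀≤n (bounded n (m+n≤o⇒m≤o n₀ n₀≤n) G CG) (W⇒W′ G CG)
  where
  E : ℕ
  E = e * suc q
  power : ∀ k → f (2 + k) ^ suc q ≤ (2 + k) ^ E
  power k = ≤-trans (^-monoˡ-≤ (suc q) (f≤ (2 + k) (m≤m+n 2 k))) (≤-reflexive (^-*-assoc (2 + k) e (suc q)))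
  small-or-large : ∀ n k → 3 ^ E ≤ n → k ^ suc (2 * E) ≤ n → (2 + k) ^ E ≤ n
  small-or-large n zero          3^E≤n _   = ≤-trans (^-monoˡ-≤ E (s≤s (s≤s z≤n))) 3^E≤n
  small-or-large n (suc zero)    3^E≤n _   = 3^E≤n
  small-or-large n k@(suc (suc j)) _   k^≤n = begin
    (2 + k) ^ E         ≤⟨ ^-monoˡ-≤ E 2+k≤ ⟩
    (k ^ 2) ^ E         ≡⟨ ^-*-assoc k 2 E ⟩
    k ^ (2 * E)         ≤⟨ ^-monoʳ-≤ k (n≤1+n (2 * E)) ⟩
    k ^ suc (2 * E)     ≤⟨ k^≤n ⟩
    n                   ∎
    where
    open ≤-Reasoning
    2+k≤ : 2 + k ≤ k ^ 2
    2+k≤ = begin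
      2 + k        ≤⟨ +-monoˡ-≤ k (s≤s (s≤s z≤n)) ⟩
      k + k        ≡⟨ cong (k +_) (+-identityʳ k) ⟨
      2 * k        ≤⟨ *-monoˡ-≤ k {2} {k} (s≤s (s≤s z≤n)) ⟩
      k * k        ≡⟨ cong (k *_) (*-identityʳ k) ⟨
      k ^ 2        ∎
  result : ∀ n → n₀ + 3 ^ E ≤ n → ∀ {G : Graph n} → (Σ ℕ λ k → k ^ suc (2 * E) ≤ n × W r′ k G) →
    (∀ {k} → W r′ k G → W′ r (f (2 + k)) G) → Σ ℕ λ k → k ^ suc q ≤ n × W′ r k G
  result n n₀≤n (k , k^≤n , w) W⇒W′ = f (2 + k) ,
    ≤-trans (power k) (small-or-large n k (m+n≤o⇒n≤o n₀ n₀≤n) k^≤n) , W⇒W′ w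

-- The implications for graph classes

DecPMW-≤ : ∀ {r k k′ n} (G : Graph n) → k ≤ k′ → DecPMW r k G → DecPMW r k′ G
DecPMW-≤ G k≤k′ (c , P? , width) = c , P? , λ t t<m v → PartsLE-≤ k≤k′ (width t t<m v)

module _ {C : GraphClass} where

  mw⇒pmw-class : AlmostBounded mwLE C → AlmostBounded pmwLE C
  mw⇒pmw-class almost r q with almost r q
  ... | n₀ , bounded = n₀ , λ n n₀≤n G CG → let (k , k^≤n , w) = bounded n n₀≤n G CG in k , k^≤n , mw⇒pmw G w

  tmw⇒pmw-class : AlmostBounded tmwLE C → AlmostBounded pmwLE C
  tmw⇒pmw-class almost r q with almost r q
  ... | n₀ , bounded = n₀ , λ n n₀≤n G CG → let (k , k^≤n , w) = bounded n n₀≤n G CG in k , k^≤n , tmw⇒pmw G w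

  private
    dmw⇒DecPMW′ : ∀ {r k n} (G : Graph n) → dmwLE r k G → DecPMW r ((2 + k) * 2) G
    dmw⇒DecPMW′ {k = k} G w = DecPMW-≤ G (s≤s (m≤n+m (k * 2) 3)) (dmw⇒DecPMW G w)

  dmw⇒pmw-class : AlmostBounded dmwLE C → AlmostBounded pmwLE C
  dmw⇒pmw-class = almostBounded-transfer λ r → r , (λ K → K * 2) , poly-* poly-id (poly-const 2) ,
    λ G CG w → let (c , _ , width) = dmw⇒DecPMW′ G w in c , width

  module _ (hereditary : Hereditary C) (almost : AlmostBounded pmwLE C) where

    private
      d : ℕ
      d = proj₁ (noShatter hereditary almost)

      noShatter-d : ∀ {n} (G : Graph n) → C n G → NoShatter G d
      noShatter-d = proj₂ (noShatter hereditary almost)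

      dmw⇒DecMW : ∀ {r k n} (G : Graph n) → C n G → dmwLE (suc (r * 5)) k G → DecMW r (classBound d ((2 + k) * 2)) G
      dmw⇒DecMW G CG w = partition⇒merge G (noShatter-d G CG) (s≤s z≤n) (dmw⇒DecPMW′ G w)

      poly : PolyBounded λ K → classBound d (K * 2)
      poly = poly-classBound d (poly-* poly-id (poly-const 2))

    pmw⇒dmw-class : AlmostBounded dmwLE C
    pmw⇒dmw-class = almostBounded-transfer (λ r → suc (suc (r * 6) * 5) , (λ K → definableBound r d (classBound d K)) ,
      poly-definableBound r d (poly-classBound d poly-id) , λ G CG {k} w →
        -- The existence of an order is decidable, so the decidable chain may be taken from under a
        -- double negation.
        definableOrder⇒dmw G (decidable-stable (definableOrder? r (definableBound r d (classBound d (2 + k))) G) λ ¬order →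
          pmw⇒¬¬DecPMW G w λ w′ → ¬order
            (merge⇒definable G (noShatter-d G CG) (s≤s z≤n)
              (partition⇒merge G (noShatter-d G CG) (s≤s z≤n) (DecPMW-≤ G (m≤n+m k 2) w′))))) almost

    pmw⇒mw-class : AlmostBounded mwLE C
    pmw⇒mw-class = almostBounded-transfer (λ r → suc (r * 5) , (λ K → classBound d (K * 2)) , poly ,
      λ G CG w → DecMW⇒mw G (dmw⇒DecMW G CG w)) pmw⇒dmw-class

    pmw⇒tmw-class : AlmostBounded tmwLE C
    pmw⇒tmw-class = almostBounded-transfer (λ r → suc (r * 5) , (λ K → classBound d (K * 2)) , poly ,
      λ G CG w → DecMW⇒tmw G (dmw⇒DecMW G CG w)) pmw⇒dmw-class

theorem1p3 : (C : GraphClass) → Hereditary C →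
    (AlmostBounded mwLE C ⇔ AlmostBounded tmwLE C) ×
    (AlmostBounded mwLE C ⇔ AlmostBounded pmwLE C) ×
    (AlmostBounded mwLE C ⇔ AlmostBounded dmwLE C)
theorem1p3 C hereditary =
  mk⇔ (pmw⇒tmw-class hereditary ∘ mw⇒pmw-class) (pmw⇒mw-class hereditary ∘ tmw⇒pmw-class) ,
  mk⇔ mw⇒pmw-class (pmw⇒mw-class hereditary) ,
  mk⇔ (pmw⇒dmw-class hereditary ∘ mw⇒pmw-class) (pmw⇒mw-class hereditary ∘ dmw⇒pmw-class)
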